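{- Let $2\le d\le n-1$. Among all trees on $n$ vertices with diameter $d$, $C_{n,d,\lfloor d/2\rfloor}$ is the unique tree having maximal Harary index.
   Context: The Harary index of a connected graph $G$ is $H(G)=\sum_{\{x,y\}\subseteq V(G),\,x\ne y}\frac{1}{d(x,y)}$, $d(x,y)$ the shortest-path distance; the diameter is the maximum distance between two vertices. For $1\le i\le d-1$, $C_{n,d,i}$ is the caterpillar on $n$ vertices obtained from a path $v_0v_1\dots v_d$ by attaching $n-d-1$ pendent vertices to $v_i$. -}

module Defs where

open import Data.Bool using (Bool; true; false; _∧_; _∨_; not; T)
open import Data.Nat using (ℕ; zero; suc; _≤_; _<_; _≡ᵇ_; _≤ᵇ_; _<ᵇ_)
open import Data.Fin using (Fin; toℕ; inject₁; fromℕ)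
import Data.Fin as F
open import Data.List using (List; allFin)
open import Data.Bool.ListAction using (any)
open import Data.Integer using (+_)
open import Data.Rational using (ℚ; 0ℚ; _/_; _+_)
open import Data.Product using (∃-syntax; _×_; Σ-syntax)
open import Data.Empty using (⊥)
open import Function.Bundles using (_↔_; Inverse)
open import Function.Definitions using (Injective)
open import Relation.Binary.PropositionalEquality using (_≡_)

Graph : ℕ → Set
Graph n = Fin n → Fin n → Bool

IsSimple : ∀ {n} → Graph n → Set
IsSimple {n} G = (∀ x y → G x y ≡ G y x) × (∀ x → G x x ≡ false)

reach : ∀ {n} → Graph n → ℕ → Fin n → Fin n → Bool
reach G zero x y = toℕ x ≡ᵇ toℕ y
reach {n} G (suc k) x y = reach G k x y ∨ any (λ z → G x z ∧ reach G k z y) (allFin n)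

Connected : ∀ {n} → Graph n → Set
Connected G = ∀ x y → ∃[ k ] T (reach G k x y)

-- least f m = the least k < m with f k = true (and m if there is none).
least : (ℕ → Bool) → ℕ → ℕ
least f zero = zero
least f (suc m) with f zero
... | true = zero
... | false = suc (least (λ k → f (suc k)) m)

-- Shortest-path distance. In a connected graph on n vertices every distance
-- is < n, so searching k < n finds the least k with a walk of length ≤ k.
dist : ∀ {n} → Graph n → Fin n → Fin n → ℕ
dist {n} G x y = least (λ k → reach G k x y) n

record Cycle {n} (G : Graph n) : Set where
  field
    k : ℕ
    c : Fin (suc (suc (suc k))) → Fin n
    inj : Injective _≡_ _≡_ c
    step : ∀ (j : Fin (suc (suc k))) → T (G (c (inject₁ j)) (c (F.suc j)))
    close : T (G (c (fromℕ (suc (suc k)))) (c F.zero))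

Acyclic : ∀ {n} → Graph n → Set
Acyclic G = Cycle G → ⊥

IsTree : ∀ {n} → Graph n → Set
IsTree G = IsSimple G × Connected G × Acyclic G

HasDiameter : ∀ {n} → Graph n → ℕ → Set
HasDiameter G d = (∀ x y → dist G x y ≤ d) × (∃[ x ] ∃[ y ] (dist G x y ≡ d))

-- 1/k (with the irrelevant value 0 for k = 0, which never occurs for x ≠ y).
recip : ℕ → ℚ
recip zero = 0ℚ
recip (suc k) = + 1 / suc k

sumFin : ∀ {m} → (Fin m → ℚ) → ℚ
sumFin {zero} f = 0ℚ
sumFin {suc m} f = f F.zero + sumFin (λ i → f (F.suc i))

harary : ∀ {n} → Graph n → ℚ
harary G = sumFin (λ x → sumFin (λ y →
  if-lt (toℕ x <ᵇ toℕ y) (recip (dist G x y))))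
  where
  if-lt : Bool → ℚ → ℚ
  if-lt true q = q
  if-lt false q = 0ℚ

-- The caterpillar C_{n,d,i}: path 0 - 1 - … - d, and every vertex a > d
-- is a pendent vertex attached to i.
caterpillar : (n d i : ℕ) → Graph n
caterpillar n d i x y =
     ((a ≤ᵇ d) ∧ (b ≤ᵇ d) ∧ ((suc a ≡ᵇ b) ∨ (suc b ≡ᵇ a)))
  ∨ ((d <ᵇ a) ∧ (b ≡ᵇ i))
  ∨ ((d <ᵇ b) ∧ (a ≡ᵇ i))
  where
  a = toℕ x
  b = toℕ y

_≅_ : ∀ {n} → Graph n → Graph n → Set
_≅_ {n} G H = Σ[ σ ∈ (Fin n ↔ Fin n) ] (∀ x y → G x y ≡ H (Inverse.to σ x) (Inverse.to σ y))

{-# OPTIONS --safe #-}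
module Submission where

-- Fix a path v₀ … v_d realising the diameter and root the tree at v₀. An off-path vertex w at
-- height h above its foot v_f is at distance h + |f − j| from v_j. Bound 1/d(w,w′) for two
-- off-path vertices by ½, plus an excess ½ charged to w when w′ is the parent of w; such a w has
-- h ≥ 2, and lowering it to h = 1 already gains ½ on the pair (w, v_f) alone. Hence every
-- off-path vertex contributes at most Σ_j 1/(1 + |f − j|), which is largest exactly for the
-- central feet. In the caterpillar all these bounds are attained; conversely equality forces
-- h = 1, a central foot, and a common foot since off-path vertices must be at distance two.

open import Defs
open import Data.Bool using (Bool; true; false; T; _∨_; _∧_; if_then_else_)
open import Data.Bool.Properties using (T-∧; T-∨)
open import Data.Nat using (ℕ; zero; suc; _+_; _∸_; _≤_; _<_; _≤?_; _<?_; ∣_-_∣; ⌊_/2⌋; z≤n; s≤s; s≤s⁻¹; _≡ᵇ_; _≤ᵇ_; _<ᵇ_)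
open import Data.Nat.Properties hiding (_≟_; _≤?_; _<?_)
open import Data.Fin as F using (Fin; toℕ; fromℕ; fromℕ<; inject₁)
open import Data.Fin.Properties as F using (_≟_)
open import Data.Fin.Permutation as P using (Permutation; _⟨$⟩ʳ_; _⟨$⟩ˡ_; _∘ₚ_; transpose; inverseˡ; inverseʳ)
open import Data.Fin.Relation.Unary.Top using (view; ‵fromℕ; ‵inject₁)
import Data.Integer as ℤ
import Data.Integer.Properties as ℤ
open import Data.Rational using (ℚ; 0ℚ; ½) renaming (_+_ to _+ℚ_; _≤_ to _≤ℚ_; _<_ to _<ℚ_)
import Data.Rational.Properties as ℚ
import Data.Rational.Unnormalised as ℚᵘ
import Data.Rational.Unnormalised.Properties as ℚᵘ
import Algebra.Properties.CommutativeMonoid.Sum ℚ.+-0-commutativeMonoid as Sum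
open import Data.List using (allFin)
open import Data.List.Relation.Unary.Any using (satisfied)
open import Data.List.Relation.Unary.Any.Properties using (any⁺; any⁻)
open import Data.List.Membership.Propositional using (lose)
open import Data.List.Membership.Propositional.Properties using (∈-allFin)
open import Data.Unit using (⊤; tt)
open import Data.Product using (Σ-syntax; ∃-syntax; _×_; _,_; proj₁; proj₂)
open import Data.Sum using (_⊎_; inj₁; inj₂; [_,_]′; swap)
open import Data.Empty using (⊥; ⊥-elim)
open import Function using (_∘_; Equivalence)
open import Relation.Nullary using (¬_; Dec; yes; no; does)
open import Relation.Nullary.Decidable using (¬?; dec-true; dec-false)
open import Relation.Binary.Definitions using (tri<; tri≈; tri>)
open import Relation.Binary.PropositionalEquality

-- The excess is charged to the child because a vertex may have many children but has one parent:
-- each row then carries at most one extra ½, whatever the shape of the tree. The constant is the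
-- gap between 1/1, for adjacent vertices, and 1/2, for two pendent vertices of the caterpillar. To
-- compare two graphs entry by entry, the tree is relabelled so that its path carries the labels 0,
-- ..., d, and the index is doubled into a sum over ordered pairs, which no relabelling changes.
-- Both doubled sums are set against matrices A + B + Bᵀ with the same A, so only the row sums of B
-- have to be compared. Equal indices close the chain of inequalities into a loop and make every
-- link tight, down to single entries. The inequality uses only lower bounds for distances in the
-- tree and upper bounds in the caterpillar. The former rest on every edge joining a vertex to its
-- parent, which is where acyclicity acts. For odd d there are two central feet, and the path may
-- have to be read backwards to match the caterpillar.

private variable
  m n : ℕ

-- Rational sums

-- A strict gap in one summand would survive the addition. Stated with inequalities only, so that it
-- can be iterated through nested sums in the equality case.
+-rigidˡ : ∀ {p q r s} → p ≤ℚ q → r ≤ℚ s → q +ℚ s ≤ℚ p +ℚ r → q ≤ℚ p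
+-rigidˡ p≤q r≤s le = ℚ.≮⇒≥ λ p<q → ℚ.<-irrefl refl (ℚ.<-≤-trans (ℚ.+-mono-<-≤ p<q r≤s) le)

+-rigidʳ : ∀ {p q r s} → p ≤ℚ q → r ≤ℚ s → q +ℚ s ≤ℚ p +ℚ r → s ≤ℚ r
+-rigidʳ p≤q r≤s le = ℚ.≮⇒≥ λ r<s → ℚ.<-irrefl refl (ℚ.<-≤-trans (ℚ.+-mono-≤-< p≤q r<s) le)

double-cancel-≤ : ∀ {p q} → p +ℚ p ≤ℚ q +ℚ q → p ≤ℚ q
double-cancel-≤ le = ℚ.≮⇒≥ λ q<p → ℚ.<-irrefl refl (ℚ.<-≤-trans (ℚ.+-mono-< q<p q<p) le)

p≤p+q : ∀ {p q} → 0ℚ ≤ℚ q → p ≤ℚ p +ℚ q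
p≤p+q {p} {q} 0≤q = subst (_≤ℚ p +ℚ q) (ℚ.+-identityʳ p) (ℚ.+-monoʳ-≤ p 0≤q)

p≤q+p : ∀ {p q} → 0ℚ ≤ℚ q → p ≤ℚ q +ℚ p
p≤q+p {p} {q} 0≤q = subst (_≤ℚ q +ℚ p) (ℚ.+-identityˡ p) (ℚ.+-monoˡ-≤ p 0≤q)

sumFin≡sum : (f : Fin m → ℚ) → sumFin f ≡ Sum.sum f
sumFin≡sum {zero} f = refl
sumFin≡sum {suc m} f = cong (f F.zero +ℚ_) (sumFin≡sum (f ∘ F.suc))

sumFin-cong : {f g : Fin m → ℚ} → (∀ i → f i ≡ g i) → sumFin f ≡ sumFin g
sumFin-cong {zero} eq = refl
sumFin-cong {suc m} eq = cong₂ _+ℚ_ (eq F.zero) (sumFin-cong (eq ∘ F.suc))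

sumFin-mono : {f g : Fin m → ℚ} → (∀ i → f i ≤ℚ g i) → sumFin f ≤ℚ sumFin g
sumFin-mono {zero} le = ℚ.≤-refl
sumFin-mono {suc m} le = ℚ.+-mono-≤ (le F.zero) (sumFin-mono (le ∘ F.suc))

sumFin-rigid : {f g : Fin m → ℚ} → (∀ i → f i ≤ℚ g i) → sumFin g ≤ℚ sumFin f → ∀ i → g i ≤ℚ f i
sumFin-rigid le eq F.zero = +-rigidˡ (le F.zero) (sumFin-mono (le ∘ F.suc)) eq
sumFin-rigid le eq (F.suc i) =
  sumFin-rigid (le ∘ F.suc) (+-rigidʳ (le F.zero) (sumFin-mono (le ∘ F.suc)) eq) i

sumFin-+ : (f g : Fin m → ℚ) → sumFin (λ i → f i +ℚ g i) ≡ sumFin f +ℚ sumFin g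
sumFin-+ f g = trans (sumFin≡sum (λ i → f i +ℚ g i))
  (trans (Sum.∑-distrib-+ f g) (sym (cong₂ _+ℚ_ (sumFin≡sum f) (sumFin≡sum g))))

sumFin-0 : sumFin {m} (λ _ → 0ℚ) ≡ 0ℚ
sumFin-0 {zero} = refl
sumFin-0 {suc m} = trans (ℚ.+-identityˡ _) (sumFin-0 {m})

sumFin-permute : (f : Fin n → ℚ) (π : Permutation n n) → sumFin (λ i → f (π ⟨$⟩ʳ i)) ≡ sumFin f
sumFin-permute f π = trans (sumFin≡sum (λ i → f (π ⟨$⟩ʳ i))) (trans (sym (Sum.sum-permute f π)) (sym (sumFin≡sum f)))

sumFin² : (Fin n → Fin n → ℚ) → ℚ
sumFin² f = sumFin λ x → sumFin λ y → f x y

sumFin²-cong : {f g : Fin n → Fin n → ℚ} → (∀ x y → f x y ≡ g x y) → sumFin² f ≡ sumFin² g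
sumFin²-cong eq = sumFin-cong λ x → sumFin-cong (eq x)

sumFin²-mono : {f g : Fin n → Fin n → ℚ} → (∀ x y → f x y ≤ℚ g x y) → sumFin² f ≤ℚ sumFin² g
sumFin²-mono le = sumFin-mono λ x → sumFin-mono (le x)

sumFin²-rigid : {f g : Fin n → Fin n → ℚ} → (∀ x y → f x y ≤ℚ g x y) →
  sumFin² g ≤ℚ sumFin² f → ∀ x y → g x y ≤ℚ f x y
sumFin²-rigid le eq x = sumFin-rigid (le x) (sumFin-rigid (λ x → sumFin-mono (le x)) eq x)

sumFin²-+ : (f g : Fin n → Fin n → ℚ) → sumFin² (λ x y → f x y +ℚ g x y) ≡ sumFin² f +ℚ sumFin² g
sumFin²-+ f g = trans (sumFin-cong λ x → sumFin-+ (f x) (g x)) (sumFin-+ (sumFin ∘ f) (sumFin ∘ g))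

sumFin²-swap : (f : Fin n → Fin n → ℚ) → sumFin² (λ x y → f y x) ≡ sumFin² f
sumFin²-swap f = trans (sum²≡ (λ x y → f y x)) (trans (Sum.∑-comm (λ x y → f y x)) (sym (sum²≡ f)))
  where
  sum²≡ : ∀ g → sumFin² g ≡ Sum.sum λ x → Sum.sum λ y → g x y
  sum²≡ g = trans (sumFin-cong λ x → sumFin≡sum (g x)) (sumFin≡sum (Sum.sum ∘ g))

sumFin²-permute : (f : Fin n → Fin n → ℚ) (π : Permutation n n) →
  sumFin² (λ x y → f (π ⟨$⟩ʳ x) (π ⟨$⟩ʳ y)) ≡ sumFin² f
sumFin²-permute f π = trans (sumFin-cong λ x → sumFin-permute (f (π ⟨$⟩ʳ x)) π)
  (sumFin-permute (λ x → sumFin (f x)) π)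

guard : {P : Set} → Dec P → ℚ → ℚ
guard (yes _) q = q
guard (no _) q = 0ℚ

guard-≥0 : {P : Set} (P? : Dec P) {q : ℚ} → 0ℚ ≤ℚ q → 0ℚ ≤ℚ guard P? q
guard-≥0 (yes _) le = le
guard-≥0 (no _) le = ℚ.≤-refl

guard-yes : {P : Set} (P? : Dec P) {q : ℚ} → P → guard P? q ≡ q
guard-yes (yes _) p = refl
guard-yes (no ¬p) p = ⊥-elim (¬p p)

guard-no : {P : Set} (P? : Dec P) {q : ℚ} → ¬ P → guard P? q ≡ 0ℚ
guard-no (yes p) ¬p = ⊥-elim (¬p p)
guard-no (no _) ¬p = refl

sumFin-δ : (c : Fin n) (q : ℚ) → sumFin (λ b → guard (b F.≟ c) q) ≡ q
sumFin-δ {suc n} F.zero q =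
  trans (cong (q +ℚ_) (trans (sumFin-cong {n} λ b → guard-no (F.suc b F.≟ F.zero) {q} λ ()) (sumFin-0 {n}))) (ℚ.+-identityʳ q)
sumFin-δ {suc n} (F.suc c) q = trans (ℚ.+-identityˡ _) (trans (sumFin-cong shift) (sumFin-δ c q))
  where
  shift : ∀ b → guard (F.suc b F.≟ F.suc c) q ≡ guard (b F.≟ c) q
  shift b with b F.≟ c
  ... | yes _ = refl
  ... | no _ = refl

sumℕ : ℕ → (ℕ → ℚ) → ℚ
sumℕ zero f = 0ℚ
sumℕ (suc m) f = f 0 +ℚ sumℕ m (f ∘ suc)

sumℕ-last : ∀ m (f : ℕ → ℚ) → sumℕ (suc m) f ≡ sumℕ m f +ℚ f m
sumℕ-last zero f = ℚ.+-comm (f 0) 0ℚ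
sumℕ-last (suc m) f = trans (cong (f 0 +ℚ_) (sumℕ-last m (f ∘ suc))) (sym (ℚ.+-assoc (f 0) _ _))

sumFin-guard-< : ∀ m {n} → m ≤ n → (f : ℕ → ℚ) →
  sumFin {n} (λ b → guard (toℕ b <? m) (f (toℕ b))) ≡ sumℕ m f
sumFin-guard-< zero {n} le f = trans (sumFin-cong {n} λ b → guard-no (toℕ b <? 0) {f (toℕ b)} λ ()) (sumFin-0 {n})
sumFin-guard-< (suc m) {suc n} (s≤s le) f =
  cong (f 0 +ℚ_) (trans (sumFin-cong shift) (sumFin-guard-< m le (f ∘ suc)))
  where
  shift : ∀ (b : Fin n) → guard (suc (toℕ b) <? suc m) (f (suc (toℕ b))) ≡ guard (toℕ b <? m) (f (suc (toℕ b)))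
  shift b with toℕ b <? m
  ... | yes lt = guard-yes (suc (toℕ b) <? suc m) (s≤s lt)
  ... | no ¬lt = guard-no (suc (toℕ b) <? suc m) (¬lt ∘ s≤s⁻¹)

-- Opaque, because recip reduces to a normalised fraction on which unification gets lost.
opaque

  inv : ℕ → ℚ
  inv = recip

  inv≡recip : ∀ k → inv k ≡ recip k
  inv≡recip k = refl

  inv-0 : inv 0 ≡ 0ℚ
  inv-0 = refl

  inv-1 : inv 1 ≡ ½ +ℚ ½
  inv-1 = refl

  inv-2 : inv 2 ≡ ½
  inv-2 = refl

  inv-< : ∀ {a b} → 0 < a → a < b → inv b <ℚ inv a
  inv-< {suc a} {suc b} _ (s≤s a<b) = ℚ.toℚᵘ-cancel-<
    (ℚᵘ.<-respʳ-≃ (ℚᵘ.≃-sym (ℚ.toℚᵘ-fromℚᵘ (ℚᵘ.mkℚᵘ (ℤ.+ 1) a)))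
      (ℚᵘ.<-respˡ-≃ (ℚᵘ.≃-sym (ℚ.toℚᵘ-fromℚᵘ (ℚᵘ.mkℚᵘ (ℤ.+ 1) b)))
        (ℚᵘ.*<* (subst₂ ℤ._<_ (sym (ℤ.*-identityˡ _)) (sym (ℤ.*-identityˡ _)) (ℤ.+<+ (s≤s a<b))))))

  inv-≤ : ∀ {a b} → 0 < a → a ≤ b → inv b ≤ℚ inv a
  inv-≤ 0<a a≤b with m≤n⇒m<n∨m≡n a≤b
  ... | inj₁ a<b = ℚ.<⇒≤ (inv-< 0<a a<b)
  ... | inj₂ refl = ℚ.≤-refl

  -- The second alternative comes from the convention `inv 0 ≡ 0ℚ`.
  inv-≤⁻¹ : ∀ {a b} → 0 < b → inv a ≤ℚ inv b → b ≤ a ⊎ a ≡ 0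
  inv-≤⁻¹ {zero} {b} 0<b le = inj₂ refl
  inv-≤⁻¹ {suc a} {b} 0<b le = inj₁ (≮⇒≥ λ a<b → ℚ.<-irrefl refl (ℚ.<-≤-trans (inv-< (s≤s z≤n) a<b) le))

  inv-≥0 : ∀ a → 0ℚ ≤ℚ inv a
  inv-≥0 zero = ℚ.≤-refl
  inv-≥0 (suc a) = ℚ.<⇒≤ (ℚ.positive⁻¹ _ {{ℚ.normalize-pos 1 (suc a)}})

private
  if-lt : Bool → ℚ → ℚ
  if-lt true q = q
  if-lt false q = 0ℚ

  -- The summand of harary uses a where-bound function, so it can only be named by unification.
  summand : (G : Graph n) → Σ[ t ∈ (Fin n → Fin n → ℚ) ] harary G ≡ sumFin² t
  summand G = _ , refl

  summand≡ : (G : Graph n) → ∀ x y → proj₁ (summand G) x y ≡ if-lt (toℕ x <ᵇ toℕ y) (inv (dist G x y))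
  summand≡ G x y with toℕ x <ᵇ toℕ y
  ... | true = sym (inv≡recip (dist G x y))
  ... | false = refl

-- The cut `x < y` depends on the labels, the sum over all ordered pairs does not. The diagonal adds
-- nothing because `inv 0` vanishes.
harary+harary : (G : Graph n) → (∀ x → dist G x x ≡ 0) → (∀ x y → dist G x y ≡ dist G y x) →
  harary G +ℚ harary G ≡ sumFin² λ x y → inv (dist G x y)
harary+harary {n} G d-refl d-sym =
  trans (cong₂ _+ℚ_ lower (trans lower (sym (sumFin²-swap h))))
    (trans (sym (sumFin²-+ h (λ x y → h y x))) (sumFin²-cong merge))
  where
  h : Fin n → Fin n → ℚ
  h x y = if-lt (toℕ x <ᵇ toℕ y) (inv (dist G x y))
  lower : harary G ≡ sumFin² h
  lower = trans (proj₂ (summand G)) (sumFin²-cong (summand≡ G))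
  merge : ∀ x y → h x y +ℚ h y x ≡ inv (dist G x y)
  merge x y with toℕ x <ᵇ toℕ y in p | toℕ y <ᵇ toℕ x in q
  ... | true | true = ⊥-elim (<-asym (<ᵇ⇒< (toℕ x) (toℕ y) (subst T (sym p) _)) (<ᵇ⇒< (toℕ y) (toℕ x) (subst T (sym q) _)))
  ... | true | false = ℚ.+-identityʳ _
  ... | false | true = trans (ℚ.+-identityˡ _) (cong inv (d-sym y x))
  ... | false | false with <-cmp (toℕ x) (toℕ y)
  ... | tri< lt _ _ = ⊥-elim (subst T p (<⇒<ᵇ lt))
  ... | tri> _ _ gt = ⊥-elim (subst T q (<⇒<ᵇ gt))
  ... | tri≈ _ eq _ with F.toℕ-injective eq
  ... | refl = sym (trans (cong inv (d-refl x)) inv-0)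

-- Walks and distances

data Walk {n} (G : Graph n) : ℕ → Fin n → Fin n → Set where
  [] : ∀ {x} → Walk G 0 x x
  _∷_ : ∀ {k x y z} → T (G x z) → Walk G k z y → Walk G (suc k) x y

module _ {n} {G : Graph n} where

  reach⇒walk : ∀ k {x y} → T (reach G k x y) → ∃[ j ] j ≤ k × Walk G j x y
  reach⇒walk zero {x} {y} t with F.toℕ-injective (≡ᵇ⇒≡ (toℕ x) (toℕ y) t)
  ... | refl = 0 , z≤n , []
  reach⇒walk (suc k) {x} {y} t with Equivalence.to T-∨ t
  ... | inj₁ t′ with reach⇒walk k t′
  ...   | j , j≤k , w = j , m≤n⇒m≤1+n j≤k , w
  reach⇒walk (suc k) {x} {y} t | inj₂ a with satisfied (any⁻ (λ z → G x z ∧ reach G k z y) (allFin n) a)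
  ... | z , tz with Equivalence.to T-∧ tz
  ... | e , t′ with reach⇒walk k t′
  ... | j , j≤k , w = suc j , s≤s j≤k , e ∷ w

  reach-suc : ∀ k {x y} → T (reach G k x y) → T (reach G (suc k) x y)
  reach-suc k t = Equivalence.from T-∨ (inj₁ t)

  walk⇒reach : ∀ {j k x y} → j ≤ k → Walk G j x y → T (reach G k x y)
  walk⇒reach {zero} {zero} {x} _ [] = ≡⇒≡ᵇ (toℕ x) (toℕ x) refl
  walk⇒reach {zero} {suc k} _ [] = reach-suc k (walk⇒reach {k = k} z≤n [])
  walk⇒reach {suc j} {suc k} {x} {y} (s≤s le) (_∷_ {z = z} e w) = Equivalence.from T-∨ (inj₂
    (any⁺ (λ z → G x z ∧ reach G k z y)
      (lose (∈-allFin z) (Equivalence.from T-∧ (e , walk⇒reach le w)))))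

least-minimal : ∀ f m k → T (f k) → least f m ≤ k
least-minimal f zero k t = z≤n
least-minimal f (suc m) k t with f 0 in eq
... | true = z≤n
least-minimal f (suc m) zero t | false = ⊥-elim (subst T eq t)
least-minimal f (suc m) (suc k) t | false = s≤s (least-minimal (f ∘ suc) m k t)

least-satisfies : ∀ f m → least f m < m → T (f (least f m))
least-satisfies f (suc m) lt with f 0 in eq
... | true = subst T (sym eq) tt
... | false = least-satisfies (f ∘ suc) m (s≤s⁻¹ lt)

module _ {n} {G : Graph n} where

  walk⇒dist≤ : ∀ {k x y} → Walk G k x y → dist G x y ≤ k
  walk⇒dist≤ {k} {x} {y} w = least-minimal (λ k → reach G k x y) n k (walk⇒reach ≤-refl w)

  -- The bound excludes the default `n` of a failed search. The walk found has length at most the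
  -- distance, and minimality of the search gives equality.
  geodesic : ∀ {x y} → dist G x y < n → Walk G (dist G x y) x y
  geodesic {x} {y} lt with reach⇒walk (dist G x y) (least-satisfies (λ k → reach G k x y) n lt)
  ... | j , j≤d , w = subst (λ k → Walk G k x y) (≤-antisym j≤d (walk⇒dist≤ w)) w

  dist-refl : ∀ x → dist G x x ≡ 0
  dist-refl x = n≤0⇒n≡0 (walk⇒dist≤ [])

  dist≡0⇒≡ : ∀ {x y} → dist G x y ≡ 0 → x ≡ y
  dist≡0⇒≡ {x} {y} eq with subst (λ k → Walk G k x y) eq (geodesic (subst (_< n) (sym eq) (0<n x)))
    where
    0<n : ∀ {n} → Fin n → 0 < n
    0<n F.zero = s≤s z≤n
    0<n (F.suc _) = s≤s z≤n
  ... | [] = refl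

  ≢⇒dist>0 : ∀ {x y} → x ≢ y → 0 < dist G x y
  ≢⇒dist>0 x≢y = n≢0⇒n>0 (x≢y ∘ dist≡0⇒≡)

  snoc : ∀ {k x y z} → Walk G k x y → T (G y z) → Walk G (suc k) x z
  snoc [] e = e ∷ []
  snoc (e′ ∷ w) e = e′ ∷ snoc w e

  module _ (G-sym : ∀ x y → G x y ≡ G y x) where

    reverse : ∀ {k x y} → Walk G k x y → Walk G k y x
    reverse [] = []
    reverse (_∷_ {x = x} {z = z} e w) = snoc (reverse w) (subst T (G-sym x z) e)

    dist-sym : (∀ x y → dist G x y < n) → ∀ x y → dist G x y ≡ dist G y x
    dist-sym lt x y = ≤-antisym (walk⇒dist≤ (reverse (geodesic (lt y x)))) (walk⇒dist≤ (reverse (geodesic (lt x y))))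

  -- Source of lower bounds for distances: exhibit a function that drops by at most one along each
  -- edge.
  lipschitz⇒≤dist : (φ : Fin n → ℕ) → (∀ {x y} → T (G x y) → φ x ≤ suc (φ y)) →
    ∀ {k x y} → Walk G k x y → φ x ≤ k + φ y
  lipschitz⇒≤dist φ lip [] = ≤-refl
  lipschitz⇒≤dist φ lip (e ∷ w) = ≤-trans (lip e) (s≤s (lipschitz⇒≤dist φ lip w))

-- Non-backtracking walks in acyclic graphs

module NonBacktrackingWalks {n} (G : Graph n) (G-irrefl : ∀ x → G x x ≡ false) (acyclic : Acyclic G) where

  -- Walks are total functions on ℕ paired with a length, so that dropping the first vertex is
  -- composition with `suc`. `Turns p m` concerns the first turn of a walk of length `suc m`, which
  -- is absent when that length is 1.
  Turns : (ℕ → Fin n) → ℕ → Set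
  Turns p zero = ⊤
  Turns p (suc _) = p 0 ≢ p 2

  NonBacktracking : (ℕ → Fin n) → ℕ → Set
  NonBacktracking p zero = ⊤
  NonBacktracking p (suc m) = T (G (p 0) (p 1)) × Turns p m × NonBacktracking (p ∘ suc) m

  edge : ∀ {p m} → NonBacktracking p m → ∀ i → i < m → T (G (p i) (p (suc i)))
  edge {m = suc m} (e , _ , nb) zero _ = e
  edge {m = suc m} (e , _ , nb) (suc i) (s≤s lt) = edge nb i lt

  edge⇒≢ : ∀ {x y} → T (G x y) → x ≢ y
  edge⇒≢ {x} e refl = subst T (G-irrefl x) e

  mutual
    -- Induction on the length: the tail is already injective, so only a return to the start is
    -- left, and there the tail's injectivity makes the closed walk a genuine cycle.
    nonBacktracking-injective : ∀ {p m} → NonBacktracking p m →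
      ∀ {i j} → i ≤ m → j ≤ m → p i ≡ p j → i ≡ j
    nonBacktracking-injective nb {zero} {zero} _ _ eq = refl
    nonBacktracking-injective {m = suc m} nb {zero} {suc j} _ (s≤s j≤m) eq = ⊥-elim (no-return nb j≤m eq)
    nonBacktracking-injective {m = suc m} nb {suc i} {zero} (s≤s i≤m) _ eq = ⊥-elim (no-return nb i≤m (sym eq))
    nonBacktracking-injective {m = suc m} (_ , _ , nb) {suc i} {suc j} (s≤s i≤m) (s≤s j≤m) eq =
      cong suc (nonBacktracking-injective nb i≤m j≤m eq)

    -- If p 0 = p (1 + j) then p 1, …, p (1 + j) is a cycle.
    no-return : ∀ {p m} → NonBacktracking p (suc m) → ∀ {j} → j ≤ m → p 0 ≢ p (suc j)
    no-return (e , _ , nb) {zero} _ eq = edge⇒≢ e eq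
    no-return {m = suc m} (e , turn , nb) {suc zero} _ eq = turn eq
    no-return {p} {m} (e , _ , nb) {suc (suc j)} j≤m eq = acyclic record
      { k = j
      ; c = λ t → p (suc (toℕ t))
      ; inj = λ {s} {t} eq′ → F.toℕ-injective (nonBacktracking-injective nb (bound s) (bound t) eq′)
      ; step = λ t → subst (λ a → T (G (p (suc a)) (p (suc (suc (toℕ t)))))) (sym (F.toℕ-inject₁ t))
          (edge nb (toℕ t) (≤-trans (F.toℕ<n t) j≤m))
      ; close = subst (λ x → T (G x (p 1))) (trans eq (cong (p ∘ suc) (sym (F.toℕ-fromℕ (suc (suc j)))))) e
      }
      where
      bound : (t : Fin (suc (suc (suc j)))) → toℕ t ≤ m
      bound t = ≤-trans (s≤s⁻¹ (F.toℕ<n t)) j≤m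

-- Rooted trees

module Rooted {n} (G : Graph n) (simple : IsSimple G) (acyclic : Acyclic G)
  (dist<n : ∀ x y → dist G x y < n) (root : Fin n) where

  open NonBacktrackingWalks G (proj₂ simple) acyclic

  flip-edge : ∀ {x y} → T (G x y) → T (G y x)
  flip-edge {x} {y} = subst T (proj₁ simple x y)

  level : Fin n → ℕ
  level x = dist G x root

  private
    next : ∀ {k x y} → Walk G k x y → Fin n
    next {x = x} [] = x
    next (_∷_ {z = z} _ _) = z

    next-edge : ∀ {k x y} (w : Walk G (suc k) x y) → T (G x (next w)) × Walk G k (next w) y
    next-edge (e ∷ w) = e , w

  -- The second vertex of the chosen geodesic to the root. The root has the empty geodesic and is
  -- its own parent.
  parent : Fin n → Fin n
  parent x = next (geodesic (dist<n x root))

  level≡0⇒root : ∀ {x} → level x ≡ 0 → x ≡ root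
  level≡0⇒root = dist≡0⇒≡

  private
    parent-step : ∀ {x k} → level x ≡ suc k → T (G x (parent x)) × Walk G k (parent x) root
    parent-step {x} eq with level x | geodesic (dist<n x root)
    parent-step {x} refl | _ | w = next-edge w

  parent-edge : ∀ {x k} → level x ≡ suc k → T (G x (parent x))
  parent-edge eq = proj₁ (parent-step eq)

  level-parent : ∀ {x k} → level x ≡ suc k → level (parent x) ≡ k
  level-parent {x} {k} eq = ≤-antisym (walk⇒dist≤ (proj₂ (parent-step eq)))
    (s≤s⁻¹ (subst (_≤ suc (level (parent x))) eq
      (walk⇒dist≤ (parent-edge eq ∷ geodesic (dist<n (parent x) root)))))

  level-parent-≤ : ∀ x → level (parent x) ≤ level x
  level-parent-≤ x = by-level (level x) refl
    where
    next₀ : ∀ {y z} (w : Walk G 0 y z) → next w ≡ y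
    next₀ [] = refl
    parent₀ : level x ≡ 0 → parent x ≡ x
    parent₀ eq with level x | geodesic (dist<n x root)
    parent₀ refl | _ | w = next₀ w
    by-level : ∀ k → level x ≡ k → level (parent x) ≤ level x
    by-level zero eq = ≤-reflexive (cong level (parent₀ eq))
    by-level (suc k) eq = ≤-trans (≤-reflexive (level-parent eq)) (≤-trans (n≤1+n k) (≤-reflexive (sym eq)))

  private
    descent : Fin n → ℕ → Fin n
    descent x zero = x
    descent x (suc i) = descent (parent x) i

    ≢grandparent : ∀ {x k} → level x ≡ suc k → x ≢ parent (parent x)
    ≢grandparent {x} eq e = 1+n≰n (≤-trans (≤-reflexive (trans (sym eq) (cong level e)))
      (≤-trans (level-parent-≤ (parent x)) (≤-reflexive (level-parent eq))))

    descent-nb : ∀ k {x} → level x ≡ k → NonBacktracking (descent x) k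
    descent-nb zero eq = tt
    descent-nb (suc k) {x} eq = parent-edge eq , turn k eq , descent-nb k (level-parent eq)
      where
      turn : ∀ k → level x ≡ suc k → Turns (descent x) k
      turn zero eq = tt
      turn (suc k) eq = ≢grandparent eq

    descent-root : ∀ k {x} → level x ≡ k → descent x k ≡ root
    descent-root zero eq = level≡0⇒root eq
    descent-root (suc k) eq = descent-root k (level-parent eq)

    infixr 5 _∷ᵖ_
    _∷ᵖ_ : Fin n → (ℕ → Fin n) → ℕ → Fin n
    (x ∷ᵖ p) zero = x
    (x ∷ᵖ p) (suc i) = p i

    -- Prepending parent (p 0), parent (parent (p 0)), … produces a closed non-backtracking walk.
    no-climb : ∀ k p m → level (p 0) ≡ k → NonBacktracking p (suc m) → p (suc m) ≡ root → p 1 ≢ parent (p 0) → ⊥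
    no-climb zero p m eq nb end ne with nonBacktracking-injective nb z≤n ≤-refl (trans (level≡0⇒root eq) (sym end))
    ... | ()
    no-climb (suc k) p m eq nb end ne = no-climb k (parent (p 0) ∷ᵖ p) (suc m) (level-parent eq)
      (flip-edge (parent-edge eq) , (ne ∘ sym) , nb) end (≢grandparent eq)

  -- Any other edge `x y` would allow the walk root ... `x`, `y` ... root along the two chains of
  -- parents. It never backtracks, yet starts and ends at the same vertex. Acyclicity of the tree is
  -- used through this statement.
  edge⇒parent : ∀ {x y} → T (G x y) → y ≡ parent x ⊎ x ≡ parent y
  edge⇒parent {x} {y} e with y ≟ parent x | x ≟ parent y
  ... | yes eq | _ = inj₁ eq
  ... | no _ | yes eq = inj₂ eq
  ... | no y≢ | no x≢ = ⊥-elim (no-climb (level x) (x ∷ᵖ descent y) (level y) refl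
    (e , turns (level y) refl , descent-nb (level y) refl) (descent-root (level y) refl) y≢)
    where
    turns : ∀ k → level y ≡ k → Turns (x ∷ᵖ descent y) k
    turns zero eq = tt
    turns (suc k) eq = x≢

∣-∣-sucˡ : ∀ a b → ∣ suc a - b ∣ ≤ suc ∣ a - b ∣
∣-∣-sucˡ a zero = s≤s (≤-reflexive (sym (∣-∣-identityʳ a)))
∣-∣-sucˡ zero (suc b) = ≤-trans (n≤1+n b) (n≤1+n (suc b))
∣-∣-sucˡ (suc a) (suc b) = ∣-∣-sucˡ a b

∣-∣-predˡ : ∀ a b → ∣ a - b ∣ ≤ suc ∣ suc a - b ∣
∣-∣-predˡ a zero = ≤-trans (≤-reflexive (∣-∣-identityʳ a)) (≤-trans (n≤1+n a) (n≤1+n (suc a)))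
∣-∣-predˡ zero (suc b) = ≤-refl
∣-∣-predˡ (suc a) (suc b) = ∣-∣-predˡ a b

-- The diametral path, and height and foot relative to it

module Spine {n} (G : Graph n) (simple : IsSimple G) (acyclic : Acyclic G)
  (dist<n : ∀ x y → dist G x y < n) (root tip : Fin n) (d : ℕ)
  (tip-level : dist G tip root ≡ d) (level≤d : ∀ x → dist G x root ≤ d) where

  open Rooted G simple acyclic dist<n root public

  private
    ancestor : ℕ → Fin n
    ancestor zero = tip
    ancestor (suc k) = parent (ancestor k)

    level-ancestor : ∀ k → k ≤ d → level (ancestor k) ≡ d ∸ k
    level-ancestor zero _ = tip-level
    level-ancestor (suc k) k<d = level-parent (trans (level-ancestor k (<⇒≤ k<d)) (+-∸-assoc 1 k<d))

  -- The diametral path is taken as the chain of parents of `tip`, which makes it closed under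
  -- `parent`; it is indexed backwards so that index and level agree.
  spine : ℕ → Fin n
  spine i = ancestor (d ∸ i)

  level-spine : ∀ {i} → i ≤ d → level (spine i) ≡ i
  level-spine {i} i≤d = trans (level-ancestor (d ∸ i) (m∸n≤m d i)) (m∸[m∸n]≡n i≤d)

  parent-spine : ∀ {i} → i < d → parent (spine (suc i)) ≡ spine i
  parent-spine i<d = cong ancestor (sym (+-∸-assoc 1 i<d))

  spine-injective : ∀ {i j} → i ≤ d → j ≤ d → spine i ≡ spine j → i ≡ j
  spine-injective i≤d j≤d eq = trans (sym (level-spine i≤d)) (trans (cong level eq) (level-spine j≤d))

  -- Each level has a single spine vertex, so membership is one decidable equation.
  On : Fin n → Set
  On x = x ≡ spine (level x)

  on? : ∀ x → Dec (On x)
  on? x = x ≟ spine (level x)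

  on-spine : ∀ {i} → i ≤ d → On (spine i)
  on-spine i≤d = cong spine (sym (level-spine i≤d))

  off-level : ∀ {x} → ¬ On x → ∃[ k ] level x ≡ suc k
  off-level {x} off = by-level (level x) refl
    where
    by-level : ∀ k → level x ≡ k → ∃[ k ] level x ≡ suc k
    by-level (suc k) eq = k , eq
    by-level zero eq = ⊥-elim (off (trans (level≡0⇒root eq)
      (trans (sym (level≡0⇒root (level-spine z≤n))) (cong spine (sym eq)))))

  -- The fuel of both searches is the level of the vertex.
  private
    heightFrom footFrom : ℕ → Fin n → ℕ
    heightFrom zero x = 0
    heightFrom (suc k) x = if does (on? x) then 0 else suc (heightFrom k (parent x))
    footFrom zero x = 0
    footFrom (suc k) x = if does (on? x) then suc k else footFrom k (parent x)

    footFrom≤ : ∀ k x → footFrom k x ≤ k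
    footFrom≤ zero x = z≤n
    footFrom≤ (suc k) x with on? x
    ... | yes _ = ≤-refl
    ... | no _ = m≤n⇒m≤1+n (footFrom≤ k (parent x))

  height foot : Fin n → ℕ
  height x = heightFrom (level x) x
  foot x = footFrom (level x) x

  foot≤d : ∀ x → foot x ≤ d
  foot≤d x = ≤-trans (footFrom≤ (level x) x) (level≤d x)

  height-on : ∀ {x} → On x → height x ≡ 0
  height-on {x} on = any-fuel (level x)
    where
    any-fuel : ∀ k → heightFrom k x ≡ 0
    any-fuel zero = refl
    any-fuel (suc k) rewrite dec-true (on? x) on = refl

  foot-on : ∀ {x} → On x → foot x ≡ level x
  foot-on {x} on = any-fuel (level x)
    where
    any-fuel : ∀ k → footFrom k x ≡ k
    any-fuel zero = refl
    any-fuel (suc k) rewrite dec-true (on? x) on = refl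

  height-off : ∀ {x} → ¬ On x → height x ≡ suc (height (parent x))
  height-off {x} off with off-level off
  ... | k , eq = trans (cong (λ l → heightFrom l x) eq)
    (trans (cong (if_then 0 else suc (heightFrom k (parent x))) (dec-false (on? x) off))
      (cong (λ l → suc (heightFrom l (parent x))) (sym (level-parent eq))))

  foot-off : ∀ {x} → ¬ On x → foot x ≡ foot (parent x)
  foot-off {x} off with off-level off
  ... | k , eq = trans (cong (λ l → footFrom l x) eq)
    (trans (cong (if_then suc k else footFrom k (parent x)) (dec-false (on? x) off))
      (cong (λ l → footFrom l (parent x)) (sym (level-parent eq))))

  height≡1⇒parent : ∀ {x} → ¬ On x → height x ≡ 1 → parent x ≡ spine (foot x)
  height≡1⇒parent {x} off h≡1 with on? (parent x)
  ... | yes on = trans on (cong spine (sym (trans (foot-off off) (foot-on on))))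
  ... | no off′ with trans (sym h≡1) (trans (height-off off) (cong suc (height-off off′)))
  ...   | ()

  private
    -- The expected distance to `spine j`: climb down to the foot, then follow the spine. By
    -- `edge⇒parent`, its Lipschitz property has to be checked only between a vertex and its parent.
    potential : ℕ → Fin n → ℕ
    potential j x = height x + ∣ foot x - j ∣

    potential-spine : ∀ j {i} → i ≤ d → potential j (spine i) ≡ ∣ i - j ∣
    potential-spine j i≤d = cong₂ (λ h f → h + ∣ f - j ∣) (height-on (on-spine i≤d))
      (trans (foot-on (on-spine i≤d)) (level-spine i≤d))

    potential-parent : ∀ j x → potential j x ≤ suc (potential j (parent x)) × potential j (parent x) ≤ suc (potential j x)
    potential-parent j x with on? x
    ... | no off rewrite height-off off | foot-off off = ≤-refl , ≤-trans (n≤1+n _) (n≤1+n _)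
    ... | yes on = by-level (level x) refl
      where
      by-level : ∀ k → level x ≡ k → potential j x ≤ suc (potential j (parent x)) × potential j (parent x) ≤ suc (potential j x)
      by-level zero eq = ≤-trans (≤-reflexive (cong (potential j) (sym fixed))) (n≤1+n _)
                       , ≤-trans (≤-reflexive (cong (potential j) fixed)) (n≤1+n _)
        where
        fixed : parent x ≡ x
        fixed = trans (level≡0⇒root (n≤0⇒n≡0 (≤-trans (level-parent-≤ x) (≤-reflexive eq)))) (sym (level≡0⇒root eq))
      by-level (suc k) eq = subst₂ (λ p q → p ≤ suc q × q ≤ suc p) (sym at-x) (sym at-parent) (∣-∣-sucˡ k j , ∣-∣-predˡ k j)
        where
        k<d : k < d
        k<d = subst (_≤ d) eq (level≤d x)
        x≡ : x ≡ spine (suc k)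
        x≡ = trans on (cong spine eq)
        at-x : potential j x ≡ ∣ suc k - j ∣
        at-x = trans (cong (potential j) x≡) (potential-spine j k<d)
        at-parent : potential j (parent x) ≡ ∣ k - j ∣
        at-parent = trans (cong (potential j) (trans (cong parent x≡) (parent-spine k<d))) (potential-spine j (<⇒≤ k<d))

    potential-lipschitz : ∀ j {x y} → T (G x y) → potential j x ≤ suc (potential j y)
    potential-lipschitz j {x} {y} e with edge⇒parent e
    ... | inj₁ refl = proj₁ (potential-parent j x)
    ... | inj₂ refl = proj₂ (potential-parent j y)

  -- The potential vanishes at `spine j`. A lower bound is the useful direction, since reciprocals
  -- in the tree are bounded from above.
  dist-spine : ∀ x {j} → j ≤ d → height x + ∣ foot x - j ∣ ≤ dist G x (spine j)
  dist-spine x {j} j≤d = subst (potential j x ≤_)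
    (trans (cong (dist G x (spine j) +_) potential≡0) (+-identityʳ _))
    (lipschitz⇒≤dist (potential j) (potential-lipschitz j) (geodesic (dist<n x (spine j))))
    where
    potential≡0 : potential j (spine j) ≡ 0
    potential≡0 = trans (potential-spine j j≤d) (∣n-n∣≡0 j)

-- Relabelling along an injection

private
  transpose-fixes : ∀ {i j k : Fin n} → k ≢ i → k ≢ j → transpose i j ⟨$⟩ʳ k ≡ k
  transpose-fixes {i = i} {j} {k} k≢i k≢j
    rewrite dec-false (k ≟ i) k≢i | dec-false (k ≟ j) k≢j = refl

  transpose-maps : ∀ (i j : Fin n) → transpose i j ⟨$⟩ʳ i ≡ j
  transpose-maps i j rewrite dec-true (i ≟ i) refl = refl

permutation-injective : (σ : Permutation n n) → ∀ {a b} → σ ⟨$⟩ʳ a ≡ σ ⟨$⟩ʳ b → a ≡ b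
permutation-injective σ eq = trans (sym (inverseˡ σ)) (trans (cong (σ ⟨$⟩ˡ_) eq) (inverseˡ σ))

-- The permutation for `k` labels is corrected at label `k` by swapping its image with `u k`.
-- Earlier images are neither of the two swapped vertices, by injectivity of the permutation and of
-- `u`, so they stay put.
extend-injection : (u : ℕ → Fin n) (k : ℕ) → k ≤ n → (∀ {i j} → i < k → j < k → u i ≡ u j → i ≡ j) →
  Σ[ σ ∈ Permutation n n ] (∀ a → toℕ a < k → σ ⟨$⟩ʳ a ≡ u (toℕ a))
extend-injection u zero _ _ = P.id , λ _ ()
extend-injection {n} u (suc k) k<n inj
  with extend-injection u k (<⇒≤ k<n) (λ i<k j<k → inj (m≤n⇒m≤1+n i<k) (m≤n⇒m≤1+n j<k))
... | σ , σ-u = σ ∘ₚ transpose (σ ⟨$⟩ʳ c) (u k) , agrees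
  where
  c : Fin n
  c = fromℕ< k<n
  agrees : ∀ a → toℕ a < suc k → (σ ∘ₚ transpose (σ ⟨$⟩ʳ c) (u k)) ⟨$⟩ʳ a ≡ u (toℕ a)
  agrees a a<1+k with m≤n⇒m<n∨m≡n (s≤s⁻¹ a<1+k)
  ... | inj₁ a<k = trans (transpose-fixes
          (λ eq → <⇒≢ a<k (trans (cong toℕ (permutation-injective σ eq)) (F.toℕ-fromℕ< k<n)))
          (λ eq → <⇒≢ a<k (inj a<1+k ≤-refl (trans (sym (σ-u a a<k)) eq))))
        (σ-u a a<k)
  ... | inj₂ refl with F.toℕ-injective {i = a} {j = c} (sym (F.toℕ-fromℕ< k<n))
  ...   | eq = trans (cong (λ b → transpose (σ ⟨$⟩ʳ c) (u k) ⟨$⟩ʳ (σ ⟨$⟩ʳ b)) eq) (transpose-maps (σ ⟨$⟩ʳ c) (u k))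

T-⇔⇒≡ : ∀ {a b} → (T a → T b) → (T b → T a) → a ≡ b
T-⇔⇒≡ {true} {true} f g = refl
T-⇔⇒≡ {true} {false} f g = ⊥-elim (f _)
T-⇔⇒≡ {false} {true} f g = ⊥-elim (g _)
T-⇔⇒≡ {false} {false} f g = refl

-- The caterpillar

-- The Boolean adjacency as an inductive relation on labels, so that matching on an edge refines
-- both labels.
data CatAdj (d i : ℕ) : ℕ → ℕ → Set where
  up : ∀ {a} → a < d → CatAdj d i a (suc a)
  down : ∀ {a} → a < d → CatAdj d i (suc a) a
  pendent : ∀ {a} → d < a → CatAdj d i a i
  pendent′ : ∀ {a} → d < a → CatAdj d i i a

CatAdj-sym : ∀ {d i a b} → CatAdj d i a b → CatAdj d i b a
CatAdj-sym (up lt) = down lt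
CatAdj-sym (down lt) = up lt
CatAdj-sym (pendent lt) = pendent′ lt
CatAdj-sym (pendent′ lt) = pendent lt

module _ {n d i : ℕ} {x y : Fin n} where

  cat⇒adj : T (caterpillar n d i x y) → CatAdj d i (toℕ x) (toℕ y)
  cat⇒adj = on-labels (toℕ x) (toℕ y)
    where
    on-labels : ∀ a b → T (((a ≤ᵇ d) ∧ (b ≤ᵇ d) ∧ ((suc a ≡ᵇ b) ∨ (suc b ≡ᵇ a)))
      ∨ ((d <ᵇ a) ∧ (b ≡ᵇ i)) ∨ ((d <ᵇ b) ∧ (a ≡ᵇ i))) → CatAdj d i a b
    on-labels a b t with Equivalence.to (T-∨ {(a ≤ᵇ d) ∧ (b ≤ᵇ d) ∧ ((suc a ≡ᵇ b) ∨ (suc b ≡ᵇ a))}) t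
    on-labels a b t | inj₁ p with Equivalence.to (T-∧ {a ≤ᵇ d}) p
    ... | a≤d , p′ with Equivalence.to (T-∧ {b ≤ᵇ d}) p′
    ... | b≤d , p″ with Equivalence.to (T-∨ {suc a ≡ᵇ b}) p″
    ... | inj₁ e with ≡ᵇ⇒≡ (suc a) b e
    ...   | refl = up (≤ᵇ⇒≤ (suc a) d b≤d)
    on-labels a b t | inj₁ p | a≤d , p′ | b≤d , p″ | inj₂ e with ≡ᵇ⇒≡ (suc b) a e
    ...   | refl = down (≤ᵇ⇒≤ (suc b) d a≤d)
    on-labels a b t | inj₂ p with Equivalence.to (T-∨ {(d <ᵇ a) ∧ (b ≡ᵇ i)}) p
    ... | inj₁ q with Equivalence.to (T-∧ {d <ᵇ a}) q
    ...   | d<a , e with ≡ᵇ⇒≡ b i e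
    ...     | refl = pendent (<ᵇ⇒< d a d<a)
    on-labels a b t | inj₂ p | inj₂ q with Equivalence.to (T-∧ {d <ᵇ b}) q
    ...   | d<b , e with ≡ᵇ⇒≡ a i e
    ...     | refl = pendent′ (<ᵇ⇒< d b d<b)

  adj⇒cat : CatAdj d i (toℕ x) (toℕ y) → T (caterpillar n d i x y)
  adj⇒cat = on-labels (toℕ x) (toℕ y)
    where
    on-labels : ∀ a b → CatAdj d i a b → T (((a ≤ᵇ d) ∧ (b ≤ᵇ d) ∧ ((suc a ≡ᵇ b) ∨ (suc b ≡ᵇ a)))
      ∨ ((d <ᵇ a) ∧ (b ≡ᵇ i)) ∨ ((d <ᵇ b) ∧ (a ≡ᵇ i)))
    on-labels a b (up lt) = Equivalence.from T-∨ (inj₁ (Equivalence.from T-∧ (≤⇒≤ᵇ (<⇒≤ lt) ,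
      Equivalence.from T-∧ (≤⇒≤ᵇ lt , Equivalence.from T-∨ (inj₁ (≡⇒≡ᵇ (suc a) b refl))))))
    on-labels a b (down lt) = Equivalence.from T-∨ (inj₁ (Equivalence.from T-∧ (≤⇒≤ᵇ lt ,
      Equivalence.from T-∧ (≤⇒≤ᵇ (<⇒≤ lt) , Equivalence.from (T-∨ {suc a ≡ᵇ b}) (inj₂ (≡⇒≡ᵇ (suc b) a refl))))))
    on-labels a b (pendent lt) = Equivalence.from (T-∨ {(a ≤ᵇ d) ∧ (b ≤ᵇ d) ∧ ((suc a ≡ᵇ b) ∨ (suc b ≡ᵇ a))})
      (inj₂ (Equivalence.from T-∨ (inj₁ (Equivalence.from T-∧ (<⇒<ᵇ lt , ≡⇒≡ᵇ b b refl)))))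
    on-labels a b (pendent′ lt) = Equivalence.from (T-∨ {(a ≤ᵇ d) ∧ (b ≤ᵇ d) ∧ ((suc a ≡ᵇ b) ∨ (suc b ≡ᵇ a))})
      (inj₂ (Equivalence.from (T-∨ {(d <ᵇ a) ∧ (b ≡ᵇ i)}) (inj₂ (Equivalence.from T-∧ (<⇒<ᵇ lt , ≡⇒≡ᵇ a a refl)))))

argmax : (f : Fin (suc m) → ℕ) → ∃[ j ] (∀ l → f l ≤ f j)
argmax {zero} f = F.zero , λ { F.zero → ≤-refl }
argmax {suc m} f with argmax (f ∘ F.suc)
... | j , max with ≤-total (f F.zero) (f (F.suc j))
... | inj₁ le = F.suc j , λ { F.zero → le ; (F.suc l) → max l }
... | inj₂ ge = F.zero , λ { F.zero → ≤-refl ; (F.suc l) → ≤-trans (max l) ge }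

-- At the first and last positions one neighbour comes from the closing edge. The two neighbours
-- differ because a cycle has at least three vertices.
cycle-neighbours : {G : Graph n} → (∀ x y → G x y ≡ G y x) → (C : Cycle G) → let open Cycle C in
  ∀ j → ∃[ p ] ∃[ q ] p ≢ q × T (G (c j) (c p)) × T (G (c j) (c q))
cycle-neighbours {G = G} G-sym C F.zero =
  F.suc F.zero , fromℕ (suc (suc k)) , (λ ()) , step F.zero , subst T (G-sym _ _) close
  where open Cycle C
cycle-neighbours {G = G} G-sym C (F.suc j) with view j
... | ‵fromℕ = inject₁ j , F.zero , (λ ()) , subst T (G-sym _ _) (step j) , close
  where open Cycle C
... | ‵inject₁ l = inject₁ j , F.suc (F.suc l) , apart , subst T (G-sym _ _) (step j) , step (F.suc l)
  where
  open Cycle C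
  apart : inject₁ (inject₁ l) ≢ F.suc (F.suc l)
  apart eq = <⇒≢ (m≤n⇒m≤1+n ≤-refl)
    (trans (sym (trans (F.toℕ-inject₁ (inject₁ l)) (F.toℕ-inject₁ l))) (cong toℕ eq))

private
  -- Below a path label lies only its predecessor, below a pendent label only `i`; the hub sees its
  -- pendent vertices above itself since `i ≤ d`.
  parent-unique : ∀ {d i a b b′} → i ≤ d → CatAdj d i a b → CatAdj d i a b′ → b ≤ a → b′ ≤ a → b ≡ b′
  parent-unique i≤d (up _) _ b≤a _ = ⊥-elim (1+n≰n b≤a)
  parent-unique i≤d (pendent′ d<a) _ b≤a _ = ⊥-elim (<⇒≱ d<a (≤-trans b≤a i≤d))
  parent-unique i≤d (down _) (up _) _ b′≤a = ⊥-elim (1+n≰n b′≤a)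
  parent-unique i≤d (down _) (down _) _ _ = refl
  parent-unique i≤d (down a<d) (pendent d<a) _ _ = ⊥-elim (<⇒≱ d<a a<d)
  parent-unique i≤d (down _) (pendent′ d<a) _ b′≤a = ⊥-elim (<⇒≱ d<a (≤-trans b′≤a i≤d))
  parent-unique i≤d (pendent _) (up _) _ b′≤a = ⊥-elim (1+n≰n b′≤a)
  parent-unique i≤d (pendent d<a) (down a<d) _ _ = ⊥-elim (<⇒≱ d<a a<d)
  parent-unique i≤d (pendent _) (pendent _) _ _ = refl
  parent-unique i≤d (pendent _) (pendent′ d<a) _ b′≤a = ⊥-elim (<⇒≱ d<a (≤-trans b′≤a i≤d))

module Caterpillar (n d i : ℕ) (0<i : 0 < i) (i<d : i < d) (d<n : d < n) where

  private
    C : Graph n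
    C = caterpillar n d i

  C-sym : ∀ x y → C x y ≡ C y x
  C-sym x y = T-⇔⇒≡ (turn x y) (turn y x)
    where
    turn : ∀ x y → T (C x y) → T (C y x)
    turn x y e = adj⇒cat {x = y} {y = x} (CatAdj-sym (cat⇒adj {x = x} {y = y} e))

  C-simple : IsSimple C
  C-simple = C-sym , λ x → T-⇔⇒≡ (loop (toℕ x) _ refl ∘ cat⇒adj) λ ()
    where
    loop : ∀ a b → a ≡ b → CatAdj d i a b → ⊥
    loop a b () (up _)
    loop a b () (down _)
    loop a b refl (pendent d<a) = <-asym d<a i<d
    loop a b refl (pendent′ d<a) = <-asym d<a i<d

  -- Every edge joins a vertex to its unique neighbour of smaller label, so the
  -- largest vertex of a cycle would have two such neighbours.
  C-acyclic : Acyclic C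
  C-acyclic cycle with argmax (toℕ ∘ Cycle.c cycle)
  ... | j , max with cycle-neighbours C-sym cycle j
  ... | p , q , p≢q , e , e′ = p≢q (Cycle.inj cycle (F.toℕ-injective
          (parent-unique (<⇒≤ i<d) (cat⇒adj e) (cat⇒adj e′) (max p) (max q))))

  private
    ascend : ∀ k {x y} → toℕ y ≤ d → k + toℕ x ≡ toℕ y → Walk C k x y
    ascend zero y≤d eq with F.toℕ-injective eq
    ... | refl = []
    ascend (suc k) {x} {y} y≤d eq =
      adj⇒cat (subst (CatAdj d i (toℕ x)) (sym z≡) (up x<d)) ∷
        ascend k y≤d (trans (cong (k +_) z≡) (trans (+-suc k (toℕ x)) eq))
      where
      x<d : toℕ x < d
      x<d = ≤-trans (s≤s (m≤n+m (toℕ x) k)) (≤-trans (≤-reflexive eq) y≤d)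
      z≡ : toℕ (fromℕ< (≤-<-trans x<d d<n)) ≡ suc (toℕ x)
      z≡ = F.toℕ-fromℕ< (≤-<-trans x<d d<n)

  -- This walk and the next two bound the caterpillar's distances from above, hence its reciprocals
  -- from below.
  walk-on-on : ∀ {x y} → toℕ x ≤ d → toℕ y ≤ d → Walk C ∣ toℕ x - toℕ y ∣ x y
  walk-on-on {x} {y} x≤d y≤d with ≤-total (toℕ x) (toℕ y)
  ... | inj₁ x≤y = subst (λ k → Walk C k x y) (sym (m≤n⇒∣m-n∣≡n∸m x≤y)) (ascend _ y≤d (m∸n+n≡m x≤y))
  ... | inj₂ y≤x = reverse C-sym (subst (λ k → Walk C k y x) (sym (m≤n⇒∣n-m∣≡n∸m y≤x)) (ascend _ x≤d (m∸n+n≡m y≤x)))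

  private
    hub : Fin n
    hub = fromℕ< (<-trans i<d d<n)

    toℕ-hub : toℕ hub ≡ i
    toℕ-hub = F.toℕ-fromℕ< (<-trans i<d d<n)

    hub-edge : ∀ {x} → d < toℕ x → T (C x hub)
    hub-edge {x} d<x = adj⇒cat (subst (CatAdj d i (toℕ x)) (sym toℕ-hub) (pendent d<x))

  walk-off-on : ∀ {x y} → d < toℕ x → toℕ y ≤ d → Walk C (suc ∣ i - toℕ y ∣) x y
  walk-off-on {x} {y} d<x y≤d = hub-edge d<x ∷
    subst (λ a → Walk C ∣ a - toℕ y ∣ hub y) toℕ-hub (walk-on-on (≤-trans (≤-reflexive toℕ-hub) (<⇒≤ i<d)) y≤d)

  walk-off-off : ∀ {x y} → d < toℕ x → d < toℕ y → Walk C 2 x y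
  walk-off-off {x} {y} d<x d<y = _∷_ {z = hub} (hub-edge d<x) (subst T (C-sym y hub) (hub-edge d<y) ∷ [])

  private
    -- Strict because the hub is an interior vertex of the path; this leaves room for the pendent
    -- edge within the diameter.
    hub-dist : ∀ {b} → b ≤ d → ∣ i - b ∣ < d
    hub-dist {b} b≤d with ≤-total i b
    ... | inj₁ i≤b = ≤-<-trans (≤-reflexive (m≤n⇒∣m-n∣≡n∸m i≤b))
      (≤-<-trans (∸-monoˡ-≤ i b≤d) (∸-monoʳ-< 0<i (<⇒≤ i<d)))
    ... | inj₂ b≤i = ≤-<-trans (≤-reflexive (m≤n⇒∣n-m∣≡n∸m b≤i)) (≤-<-trans (m∸n≤m i b) i<d)

    ∣-∣≤d : ∀ {a b} → a ≤ d → b ≤ d → ∣ a - b ∣ ≤ d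
    ∣-∣≤d {a} {b} a≤d b≤d with ≤-total a b
    ... | inj₁ a≤b = ≤-trans (≤-reflexive (m≤n⇒∣m-n∣≡n∸m a≤b)) (≤-trans (m∸n≤m b a) b≤d)
    ... | inj₂ b≤a = ≤-trans (≤-reflexive (m≤n⇒∣n-m∣≡n∸m b≤a)) (≤-trans (m∸n≤m a b) a≤d)

    short-walk : ∀ x y → ∃[ k ] k ≤ d × Walk C k x y
    short-walk x y with toℕ x ≤? d | toℕ y ≤? d
    ... | yes x≤d | yes y≤d = _ , ∣-∣≤d x≤d y≤d , walk-on-on x≤d y≤d
    ... | no x≰d | yes y≤d = _ , hub-dist y≤d , walk-off-on (≰⇒> x≰d) y≤d
    ... | yes x≤d | no y≰d = _ , hub-dist x≤d , reverse C-sym (walk-off-on (≰⇒> y≰d) x≤d)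
    -- Here 2 ≤ d, as 0 < i < d.
    ... | no x≰d | no y≰d = 2 , ≤-trans (s≤s 0<i) i<d , walk-off-off (≰⇒> x≰d) (≰⇒> y≰d)

  C-dist≤d : ∀ x y → dist C x y ≤ d
  C-dist≤d x y with short-walk x y
  ... | k , k≤d , w = ≤-trans (walk⇒dist≤ w) k≤d

  C-dist<n : ∀ x y → dist C x y < n
  C-dist<n x y = ≤-<-trans (C-dist≤d x y) d<n

  C-tree : IsTree C
  C-tree = C-simple , (λ x y → dist C x y , walk⇒reach ≤-refl (geodesic (C-dist<n x y))) , C-acyclic

  private
    -- Folds every pendent vertex onto the hub. The Lipschitz property of this map shows that the
    -- ends of the path really are at distance `d`.
    project : ℕ → ℕ
    project a = if does (a ≤? d) then a else i

    project-on : ∀ {a} → a ≤ d → project a ≡ a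
    project-on {a} a≤d = cong (if_then a else i) (dec-true (a ≤? d) a≤d)

    project-off : ∀ {a} → d < a → project a ≡ i
    project-off {a} d<a = cong (if_then a else i) (dec-false (a ≤? d) (<⇒≱ d<a))

    project-lipschitz : ∀ {a b} → CatAdj d i a b → project a ≤ suc (project b)
    project-lipschitz (up a<d) rewrite project-on a<d | project-on (<⇒≤ a<d) = ≤-trans (n≤1+n _) (n≤1+n _)
    project-lipschitz (down a<d) rewrite project-on a<d | project-on (<⇒≤ a<d) = ≤-refl
    project-lipschitz (pendent d<a) rewrite project-off d<a | project-on (<⇒≤ i<d) = n≤1+n i
    project-lipschitz (pendent′ d<a) rewrite project-off d<a | project-on (<⇒≤ i<d) = n≤1+n i

  C-diameter : HasDiameter C d
  C-diameter = C-dist≤d , last , first , ≤-antisym (C-dist≤d last first)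
    (subst₂ _≤_ (trans (cong project (F.toℕ-fromℕ< d<n)) (project-on ≤-refl))
      (trans (cong (dist C last first +_) (trans (cong project (F.toℕ-fromℕ< (≤-<-trans z≤n d<n))) (project-on z≤n))) (+-identityʳ _))
      (lipschitz⇒≤dist (project ∘ toℕ) (λ {x} {y} e → project-lipschitz (cat⇒adj {x = x} {y = y} e)) (geodesic (C-dist<n last first))))
    where
    last first : Fin n
    last = fromℕ< d<n
    first = fromℕ< (≤-<-trans z≤n d<n)

-- Recognising a caterpillar

-- The caterpillar's shape without labels, each edge in one direction: the meeting point of an
-- abstract tree and `CatAdj`.
data SpineEdge (d i : ℕ) (u : ℕ → Fin n) : Fin n → Fin n → Set where
  along : ∀ {j} → j < d → SpineEdge d i u (u j) (u (suc j))
  hanging : ∀ {x} → (∀ {j} → j ≤ d → x ≢ u j) → SpineEdge d i u x (u i)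

module _ {n} (G : Graph n) (G-sym : ∀ x y → G x y ≡ G y x) {d i : ℕ} (i≤d : i ≤ d) (d<n : d < n) (u : ℕ → Fin n)
  (u-injective : ∀ {a b} → a ≤ d → b ≤ d → u a ≡ u b → a ≡ b) where

  -- Only the path has to be matched by label. All other vertices hang at `u i` and are
  -- interchangeable, so any permutation extending `u` will do; it sends labels to vertices, hence
  -- the isomorphism is its inverse.
  ≅-caterpillar : (∀ {x y} → T (G x y) → SpineEdge d i u x y ⊎ SpineEdge d i u y x) →
    (∀ {x y} → SpineEdge d i u x y → T (G x y)) → G ≅ caterpillar n d i
  ≅-caterpillar edge⇒ edge⇐ with extend-injection u (suc d) d<n (λ a<d b<d → u-injective (s≤s⁻¹ a<d) (s≤s⁻¹ b<d))
  ... | σ , σ-u = P.flip σ , λ x y → T-⇔⇒≡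
      ([ adj⇒cat ∘ to , adj⇒cat ∘ CatAdj-sym ∘ to ]′ ∘ edge⇒)
      (subst₂ (λ x y → T (G x y)) (inverseʳ σ) (inverseʳ σ) ∘ from refl refl ∘ cat⇒adj)
    where
    label-u : ∀ {j} → j ≤ d → toℕ (σ ⟨$⟩ˡ u j) ≡ j
    label-u {j} j≤d = trans (cong toℕ (trans (cong (σ ⟨$⟩ˡ_) (sym σj)) (inverseˡ σ))) (F.toℕ-fromℕ< (≤-<-trans j≤d d<n))
      where
      σj : σ ⟨$⟩ʳ (fromℕ< (≤-<-trans j≤d d<n)) ≡ u j
      σj = trans (σ-u _ (s≤s (≤-trans (≤-reflexive (F.toℕ-fromℕ< (≤-<-trans j≤d d<n))) j≤d)))
        (cong u (F.toℕ-fromℕ< (≤-<-trans j≤d d<n)))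
    to : ∀ {x y} → SpineEdge d i u x y → CatAdj d i (toℕ (σ ⟨$⟩ˡ x)) (toℕ (σ ⟨$⟩ˡ y))
    to (along j<d) = subst₂ (CatAdj d i) (sym (label-u (<⇒≤ j<d))) (sym (label-u j<d)) (up j<d)
    to {x} (hanging off) = subst (CatAdj d i _) (sym (label-u i≤d)) (pendent (≰⇒> λ le →
      off le (trans (sym (inverseʳ σ)) (σ-u (σ ⟨$⟩ˡ x) (s≤s le)))))
    σ≡u : ∀ {a j} → toℕ a ≡ j → j ≤ d → σ ⟨$⟩ʳ a ≡ u j
    σ≡u {a} refl j≤d = σ-u a (s≤s j≤d)
    σ-off : ∀ {a} → d < toℕ a → ∀ {j} → j ≤ d → σ ⟨$⟩ʳ a ≢ u j
    σ-off {a} d<a j≤d eq = <⇒≱ d<a (≤-trans (≤-reflexive (trans (cong toℕ (sym (inverseˡ σ)))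
      (trans (cong (toℕ ∘ (σ ⟨$⟩ˡ_)) eq) (label-u j≤d)))) j≤d)
    edge⇐′ : ∀ {x y} → SpineEdge d i u x y → T (G y x)
    edge⇐′ {x} {y} e = subst T (G-sym x y) (edge⇐ e)
    from : ∀ {a b k l} → toℕ a ≡ k → toℕ b ≡ l → CatAdj d i k l → T (G (σ ⟨$⟩ʳ a) (σ ⟨$⟩ʳ b))
    from p q (up lt) rewrite σ≡u p (<⇒≤ lt) | σ≡u q lt = edge⇐ (along lt)
    from p q (down lt) rewrite σ≡u p lt | σ≡u q (<⇒≤ lt) = edge⇐′ (along lt)
    from refl q (pendent lt) rewrite σ≡u q i≤d = edge⇐ (hanging (σ-off lt))
    from p refl (pendent′ lt) rewrite σ≡u p i≤d = edge⇐′ (hanging (σ-off lt))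

reverse-injective : ∀ {d} (u : ℕ → Fin n) → (∀ {a b} → a ≤ d → b ≤ d → u a ≡ u b → a ≡ b) →
  ∀ {a b} → a ≤ d → b ≤ d → u (d ∸ a) ≡ u (d ∸ b) → a ≡ b
reverse-injective {d = d} u inj {a} {b} a≤d b≤d eq = trans (sym (m∸[m∸n]≡n a≤d))
  (trans (cong (d ∸_) (inj (m∸n≤m d a) (m∸n≤m d b) eq)) (m∸[m∸n]≡n b≤d))

module _ {d i f : ℕ} (f+i≡d : f + i ≡ d) (u : ℕ → Fin n) where

  private
    shift : ∀ {j} → j < d → d ∸ j ≡ suc (d ∸ suc j)
    shift j<d = +-∸-assoc 1 j<d

    d∸i≡f : d ∸ i ≡ f
    d∸i≡f = trans (cong (_∸ i) (sym f+i≡d)) (m+n∸n≡m f i)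

  -- Reading the path backwards exchanges the positions `f` and `i`; this brings the second central
  -- foot of an odd path to the first.
  spineEdge-reverse : ∀ {x y} → SpineEdge d f u x y →
    SpineEdge d i (λ j → u (d ∸ j)) x y ⊎ SpineEdge d i (λ j → u (d ∸ j)) y x
  spineEdge-reverse (along {j} j<d) = inj₂ (subst₂ (SpineEdge d i (λ j → u (d ∸ j)))
    (cong u (m∸[m∸n]≡n j<d)) (cong u (trans (cong (d ∸_) (sym (shift j<d))) (m∸[m∸n]≡n (<⇒≤ j<d))))
    (along (∸-monoʳ-< (s≤s z≤n) j<d)))
  spineEdge-reverse {x} (hanging off) = inj₁ (subst (SpineEdge d i (λ j → u (d ∸ j)) x) (cong u d∸i≡f)
    (hanging λ {j} _ → off (m∸n≤m d j)))

  spineEdge-unreverse : ∀ {x y} → SpineEdge d i (λ j → u (d ∸ j)) x y →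
    SpineEdge d f u x y ⊎ SpineEdge d f u y x
  spineEdge-unreverse (along {j} j<d) = inj₂ (subst (SpineEdge d f u (u (d ∸ suc j))) (cong u (sym (shift j<d)))
    (along (≤-trans (≤-reflexive (sym (shift j<d))) (m∸n≤m d j))))
  spineEdge-unreverse {x} (hanging off) = inj₁ (subst (SpineEdge d f u x) (cong u (sym d∸i≡f))
    (hanging λ {j} j≤d eq → off (m∸n≤m d j) (trans eq (cong u (sym (m∸[m∸n]≡n j≤d))))))

-- Total reciprocal distance from a pendent vertex to the spine

+-balance-≤ : ∀ {a b p q} → a +ℚ p ≡ b +ℚ q → q ≤ℚ p → a ≤ℚ b
+-balance-≤ eq q≤p = ℚ.≮⇒≥ λ b<a → ℚ.<-irrefl (sym eq) (ℚ.+-mono-<-≤ b<a q≤p)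

+-balance-< : ∀ {a b p q} → a +ℚ p ≡ b +ℚ q → q <ℚ p → a <ℚ b
+-balance-< eq q<p = ℚ.≰⇒> λ b≤a → ℚ.<-irrefl (sym eq) (ℚ.+-mono-≤-< b≤a q<p)

pendentSum : ℕ → ℕ → ℚ
pendentSum d f = sumℕ (suc d) λ b → inv (suc ∣ f - b ∣)

-- Moving the foot one step slides the window of differences: the term of the far end `d` leaves and
-- a new term for the end 0 enters. Written additively to avoid subtraction.
pendentSum-suc : ∀ d f → pendentSum d (suc f) +ℚ inv (suc ∣ f - d ∣) ≡ pendentSum d f +ℚ inv (suc (suc f))
pendentSum-suc d f = begin
  (r +ℚ s) +ℚ l  ≡⟨ ℚ.+-assoc r s l ⟩
  r +ℚ (s +ℚ l)  ≡⟨ ℚ.+-comm r (s +ℚ l) ⟩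
  (s +ℚ l) +ℚ r  ≡⟨ cong (_+ℚ r) (sym (sumℕ-last d λ b → inv (suc ∣ f - b ∣))) ⟩
  pendentSum d f +ℚ r ∎
  where
  open ≡-Reasoning
  r s l : ℚ
  r = inv (suc (suc f))
  s = sumℕ d λ b → inv (suc ∣ f - b ∣)
  l = inv (suc ∣ f - d ∣)

-- The entering term is 1/(f + 2), the leaving one 1/(1 + d - f), so the sign of d - (2f + 1)
-- decides. The next two lemmas treat the other signs.
pendentSum-increasing : ∀ {d f} → suc f + f < d → pendentSum d f <ℚ pendentSum d (suc f)
pendentSum-increasing {d} {f} lt = +-balance-< (sym (pendentSum-suc d f)) (inv-< (s≤s z≤n) (s≤s near))
  where
  near : suc f < ∣ f - d ∣
  near = ≤-trans (m+n≤o⇒m≤o∸n (suc (suc f)) lt)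
    (≤-reflexive (sym (m≤n⇒∣m-n∣≡n∸m (≤-trans (m≤n+m f (suc (suc f))) lt))))

pendentSum-decreasing : ∀ {d f} → f < d → d < suc f + f → pendentSum d (suc f) <ℚ pendentSum d f
pendentSum-decreasing {d} {f} f<d lt = +-balance-< (pendentSum-suc d f) (inv-< (s≤s z≤n) (s≤s near))
  where
  near : ∣ f - d ∣ < suc f
  near = ≤-trans (s≤s (≤-reflexive (m≤n⇒∣m-n∣≡n∸m (<⇒≤ f<d)))) (m<n+o⇒m∸n<o d f (subst (d <_) (+-comm (suc f) f) lt))

pendentSum-balanced : ∀ {d f} → d ≡ suc f + f → pendentSum d (suc f) ≤ℚ pendentSum d f
pendentSum-balanced {d} {f} refl = +-balance-≤ (pendentSum-suc d f) (ℚ.≤-reflexive (cong (inv ∘ suc)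
  (sym (trans (m≤n⇒∣m-n∣≡n∸m (m≤n+m f (suc f))) (m+n∸n≡m (suc f) f)))))

half-bounds : ∀ d → ⌊ d /2⌋ + ⌊ d /2⌋ ≤ d × d ≤ suc (⌊ d /2⌋ + ⌊ d /2⌋)
half-bounds 0 = z≤n , z≤n
half-bounds 1 = z≤n , s≤s z≤n
half-bounds (suc (suc d)) rewrite +-suc ⌊ d /2⌋ ⌊ d /2⌋ with half-bounds d
... | lo , hi = s≤s (s≤s lo) , s≤s (s≤s hi)

module _ (d : ℕ) where

  private
    i : ℕ
    i = ⌊ d /2⌋

    Maximal : ℕ → Set
    Maximal f = pendentSum d f ≤ℚ pendentSum d i × (pendentSum d i ≤ℚ pendentSum d f → f ≡ i ⊎ f + i ≡ d)

    strict : ∀ {f} → pendentSum d f <ℚ pendentSum d i → Maximal f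
    strict lt = ℚ.<⇒≤ lt , λ ge → ⊥-elim (ℚ.<-irrefl refl (ℚ.<-≤-trans lt ge))

    left : ∀ k {f} → k + f ≡ i → Maximal f
    left zero refl = ℚ.≤-refl , λ _ → inj₁ refl
    left (suc k) {f} eq = strict {f} (ℚ.<-≤-trans (pendentSum-increasing {d} {f} bound) (proj₁ (left k (trans (+-suc k f) eq))))
      where
      f<i : f < i
      f<i = ≤-trans (s≤s (m≤n+m f k)) (≤-reflexive eq)
      bound : suc f + f < d
      bound = ≤-trans (≤-reflexive (sym (+-suc (suc f) f))) (≤-trans (+-mono-≤ f<i f<i) (proj₁ (half-bounds d)))

    right : ∀ k → k + i ≤ d → Maximal (k + i)
    right zero _ = ℚ.≤-refl , λ _ → inj₁ refl
    right (suc k) le with <-cmp d (suc (k + i) + (k + i)) | right k (<⇒≤ le)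
    ... | tri< lt _ _ | prev , _ = strict {suc (k + i)} (ℚ.<-≤-trans (pendentSum-decreasing {d} {k + i} le lt) prev)
    ... | tri> _ _ gt | _ = ⊥-elim (<⇒≱ gt (≤-trans (proj₂ (half-bounds d)) (s≤s (+-mono-≤ (m≤n+m i k) (m≤n+m i k)))))
    -- A tie requires d = 2(k + i) + 1, which with d ≤ 2i + 1 leaves only k = 0: the step from one
    -- centre of an odd path to the other.
    ... | tri≈ _ eq _ | prev , _ = ℚ.≤-trans (pendentSum-balanced {d} {k + i} eq) prev , λ _ → inj₂ (centred k eq)
      where
      centred : ∀ k → d ≡ suc (k + i) + (k + i) → suc (k + i) + i ≡ d
      centred zero eq = sym eq
      centred (suc k) eq = ⊥-elim (1+n≰n (≤-trans (≤-trans
        (s≤s (s≤s (+-mono-≤ (m≤n+m i k) (≤-trans (m≤n+m i k) (n≤1+n _))))) (≤-reflexive (sym eq))) (proj₂ (half-bounds d))))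

  pendentSum-max : ∀ {f} → f ≤ d → pendentSum d f ≤ℚ pendentSum d ⌊ d /2⌋ ×
    (pendentSum d ⌊ d /2⌋ ≤ℚ pendentSum d f → f ≡ ⌊ d /2⌋ ⊎ f + ⌊ d /2⌋ ≡ d)
  pendentSum-max {f} f≤d with ≤-total f i
  ... | inj₁ f≤i = left (i ∸ f) (m∸n+n≡m f≤i)
  ... | inj₂ i≤f = subst Maximal (m∸n+n≡m i≤f) (right (f ∸ i) (≤-trans (≤-reflexive (m∸n+n≡m i≤f)) f≤d))

sumℕ-mono-≤ : ∀ m {g h : ℕ → ℚ} → (∀ b → g b ≤ℚ h b) → sumℕ m g ≤ℚ sumℕ m h
sumℕ-mono-≤ zero le = ℚ.≤-refl
sumℕ-mono-≤ (suc m) le = ℚ.+-mono-≤ (le 0) (sumℕ-mono-≤ m (le ∘ suc))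

module _ {q : ℚ} where

  private
    first : ∀ a s → (a +ℚ s) +ℚ q ≡ (a +ℚ q) +ℚ s
    first a s = trans (ℚ.+-assoc a s q) (trans (cong (a +ℚ_) (ℚ.+-comm s q)) (sym (ℚ.+-assoc a q s)))

  sumℕ-gap-≤ : ∀ m {f} {g h : ℕ → ℚ} → f < m → (∀ b → g b ≤ℚ h b) → g f +ℚ q ≤ℚ h f →
    sumℕ m g +ℚ q ≤ℚ sumℕ m h
  sumℕ-gap-≤ (suc m) {zero} {g} _ le gap =
    subst (_≤ℚ _) (sym (first (g 0) (sumℕ m (g ∘ suc)))) (ℚ.+-mono-≤ gap (sumℕ-mono-≤ m (le ∘ suc)))
  sumℕ-gap-≤ (suc m) {suc f} {g} (s≤s f<m) le gap =
    subst (_≤ℚ _) (sym (ℚ.+-assoc (g 0) _ q)) (ℚ.+-mono-≤ (le 0) (sumℕ-gap-≤ m f<m (le ∘ suc) gap))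

  -- The index `f` absorbs `q` with a weak inequality, so strictness must come from another index;
  -- hence at least two terms.
  sumℕ-gap-< : ∀ m {f} {g h : ℕ → ℚ} → f < suc (suc m) → (∀ b → g b <ℚ h b) → g f +ℚ q ≤ℚ h f →
    sumℕ (suc (suc m)) g +ℚ q <ℚ sumℕ (suc (suc m)) h
  sumℕ-gap-< m {zero} {g} _ lt gap =
    subst (_<ℚ _) (sym (first (g 0) (sumℕ (suc m) (g ∘ suc))))
      (ℚ.+-mono-≤-< gap (ℚ.+-mono-<-≤ (lt 1) (sumℕ-mono-≤ m (ℚ.<⇒≤ ∘ lt ∘ suc ∘ suc))))
  sumℕ-gap-< m {suc f} {g} (s≤s f<m) lt gap =
    subst (_<ℚ _) (sym (ℚ.+-assoc (g 0) _ q)) (ℚ.+-mono-<-≤ (lt 0) (sumℕ-gap-≤ (suc m) f<m (ℚ.<⇒≤ ∘ lt ∘ suc) gap))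

-- The vertex at the foot alone pays for the extra ½.
tallSum<pendentSum : ∀ {d f h} → 0 < d → f ≤ d → 1 < h →
  sumℕ (suc d) (λ b → inv (h + ∣ f - b ∣)) +ℚ ½ <ℚ pendentSum d f
tallSum<pendentSum {suc d} {f} {h} _ f≤d 1<h = sumℕ-gap-< d (s≤s f≤d)
  (λ b → inv-< (s≤s z≤n) (+-monoˡ-< ∣ f - b ∣ 1<h))
  (subst (λ z → inv (h + z) +ℚ ½ ≤ℚ inv (suc z)) (sym (∣n-n∣≡0 f))
    (subst₂ (λ z p → inv z +ℚ ½ ≤ℚ p) (sym (+-identityʳ h)) (sym inv-1)
      (ℚ.+-monoˡ-≤ ½ (subst (inv h ≤ℚ_) inv-2 (inv-≤ (s≤s z≤n) 1<h)))))

-- Splitting the reciprocal distances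

-- The fixed 0 in the spine/off-spine slot records mixed pairs in one order only; `split` adds the
-- transpose.
block : {A B : Set} → Dec A → Dec B → ℚ → ℚ → ℚ → ℚ
block (yes _) (yes _) p q r = p
block (yes _) (no _) p q r = 0ℚ
block (no _) (yes _) p q r = q
block (no _) (no _) p q r = r

0≤½ : 0ℚ ≤ℚ ½
0≤½ = subst (0ℚ ≤ℚ_) inv-2 (inv-≥0 2)

module Labelled (n d : ℕ) where

  onSpine? : (a : Fin n) → Dec (toℕ a < suc d)
  onSpine? a = toℕ a <? suc d

  -- The part shared by tree and caterpillar: path distances, and ½ for any two distinct off-spine
  -- labels.
  core : Fin n → Fin n → ℚ
  core a b = block (onSpine? a) (onSpine? b) (inv ∣ toℕ a - toℕ b ∣) 0ℚ (guard (¬? (a ≟ b)) ½)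

  -- Reciprocal distances from off-spine vertices a with heights h and feet f, plus
  -- an excess e charged to pairs of off-spine vertices.
  branch : (h f : Fin n → ℕ) (e : Fin n → Fin n → ℚ) → Fin n → Fin n → ℚ
  branch h f e a b = block (onSpine? a) (onSpine? b) 0ℚ (inv (h a + ∣ f a - toℕ b ∣)) (e a b)

  split : (h f : Fin n → ℕ) (e : Fin n → Fin n → ℚ) → Fin n → Fin n → ℚ
  split h f e a b = core a b +ℚ (branch h f e a b +ℚ branch h f e b a)

  -- Transposing does not change a total, so comparing two trees reduces to the row sums of
  -- `branch`.
  sum-split : ∀ h f e → sumFin² (split h f e) ≡ sumFin² core +ℚ (sumFin² (branch h f e) +ℚ sumFin² (branch h f e))
  sum-split h f e = trans (sumFin²-+ core (λ a b → branch h f e a b +ℚ branch h f e b a))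
    (cong (sumFin² core +ℚ_) (trans (sumFin²-+ (branch h f e) (λ a b → branch h f e b a))
      (cong (sumFin² (branch h f e) +ℚ_) (sumFin²-swap (branch h f e)))))

  branch-row-on : ∀ {h f e} a → toℕ a < suc d → sumFin (branch h f e a) ≡ 0ℚ
  branch-row-on {h} {f} {e} a on = trans (sumFin-cong {n} zeros) (sumFin-0 {n})
    where
    zeros : ∀ b → branch h f e a b ≡ 0ℚ
    zeros b with onSpine? a | onSpine? b
    ... | yes _ | yes _ = refl
    ... | yes _ | no _ = refl
    ... | no off | _ = ⊥-elim (off on)

  spineSum : d < n → ∀ h f → sumFin {n} (λ b → guard (onSpine? b) (inv (h + ∣ f - toℕ b ∣))) ≡
    sumℕ (suc d) λ b → inv (h + ∣ f - b ∣)
  spineSum d<n h f = sumFin-guard-< (suc d) d<n λ b → inv (h + ∣ f - b ∣)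

-- The caterpillar from below

module CaterpillarBound (n d i : ℕ) (0<i : 0 < i) (i<d : i < d) (d<n : d < n) where

  open Labelled n d
  open Caterpillar n d i 0<i i<d d<n

  private
    C : Graph n
    C = caterpillar n d i

    inv≥ : ∀ {k a b} → a ≢ b → Walk C k a b → inv k ≤ℚ inv (dist C a b)
    inv≥ a≢b w = inv-≤ (≢⇒dist>0 a≢b) (walk⇒dist≤ w)

  catBranch : Fin n → Fin n → ℚ
  catBranch = branch (λ _ → 1) (λ _ → i) (λ _ _ → 0ℚ)

  catBranch-row : ∀ a → ¬ toℕ a < suc d → sumFin (catBranch a) ≡ pendentSum d i
  catBranch-row a off = trans (sumFin-cong {n} row) (spineSum d<n 1 i)
    where
    row : ∀ b → catBranch a b ≡ guard (onSpine? b) (inv (1 + ∣ i - toℕ b ∣))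
    row b with onSpine? a | onSpine? b
    ... | yes on | _ = ⊥-elim (off on)
    ... | no _ | yes _ = refl
    ... | no _ | no _ = refl

  split≤inv-dist : ∀ a b → split (λ _ → 1) (λ _ → i) (λ _ _ → 0ℚ) a b ≤ℚ inv (dist C a b)
  split≤inv-dist a b with onSpine? a | onSpine? b
  ... | yes a≤d | no b≰d = subst (_≤ℚ inv (dist C a b)) (sym (trans (ℚ.+-identityˡ _) (ℚ.+-identityˡ _)))
        (inv≥ (λ { refl → b≰d a≤d }) (reverse C-sym (walk-off-on (≤-pred (≰⇒> b≰d)) (s≤s⁻¹ a≤d))))
  ... | no a≰d | yes b≤d = subst (_≤ℚ inv (dist C a b)) (sym (trans (ℚ.+-identityˡ _) (ℚ.+-identityʳ _)))
        (inv≥ (λ { refl → a≰d b≤d }) (walk-off-on (≤-pred (≰⇒> a≰d)) (s≤s⁻¹ b≤d)))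
  ... | yes a≤d | yes b≤d = subst (_≤ℚ inv (dist C a b)) (sym (ℚ.+-identityʳ _)) by-equality
    where
    by-equality : inv ∣ toℕ a - toℕ b ∣ ≤ℚ inv (dist C a b)
    by-equality with a ≟ b
    ... | yes refl rewrite ∣n-n∣≡0 (toℕ a) | inv-0 = inv-≥0 (dist C a a)
    ... | no a≢b = inv≥ a≢b (walk-on-on (s≤s⁻¹ a≤d) (s≤s⁻¹ b≤d))
  ... | no a≰d | no b≰d = subst (_≤ℚ inv (dist C a b)) (sym (ℚ.+-identityʳ _)) by-equality
    where
    by-equality : guard (¬? (a ≟ b)) ½ ≤ℚ inv (dist C a b)
    by-equality with a ≟ b
    ... | yes _ = inv-≥0 (dist C a b)
    ... | no a≢b = subst (_≤ℚ inv (dist C a b)) inv-2 (inv≥ a≢b (walk-off-off (≤-pred (≰⇒> a≰d)) (≤-pred (≰⇒> b≰d))))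

-- An arbitrary tree from above

module TreeBound {n} (G : Graph n) (simple : IsSimple G) (acyclic : Acyclic G)
  (dist<n : ∀ x y → dist G x y < n) (root tip : Fin n) (d : ℕ)
  (tip-level : dist G tip root ≡ d) (level≤d : ∀ x → dist G x root ≤ d) (0<d : 0 < d) (d<n : d < n) where

  open Spine G simple acyclic dist<n root tip d tip-level level≤d
  open Labelled n d

  opaque
    -- Gives the spine the labels that the caterpillar's path has, so that the two distance matrices
    -- can be compared entrywise.
    labelling : Σ[ σ ∈ Permutation n n ] (∀ a → toℕ a < suc d → σ ⟨$⟩ʳ a ≡ spine (toℕ a))
    labelling = extend-injection spine (suc d) d<n λ p q → spine-injective (s≤s⁻¹ p) (s≤s⁻¹ q)

  σ : Permutation n n
  σ = proj₁ labelling

  σ-spine : ∀ a → toℕ a < suc d → σ ⟨$⟩ʳ a ≡ spine (toℕ a)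
  σ-spine = proj₂ labelling

  -- A spine vertex at level l is already the image of label l ≤ d, so injectivity leaves it no
  -- other label.
  off⇒¬On : ∀ {a} → ¬ toℕ a < suc d → ¬ On (σ ⟨$⟩ʳ a)
  off⇒¬On {a} off on = off (subst (λ b → toℕ b < suc d) (sym a≡b) (s≤s (≤-trans (≤-reflexive toℕb) (level≤d x))))
    where
    x b : Fin n
    x = σ ⟨$⟩ʳ a
    b = fromℕ< (dist<n x root)
    toℕb : toℕ b ≡ level x
    toℕb = F.toℕ-fromℕ< (dist<n x root)
    a≡b : a ≡ b
    a≡b = permutation-injective σ (trans on (trans (cong spine (sym toℕb))
      (sym (σ-spine b (s≤s (≤-trans (≤-reflexive toℕb) (level≤d x)))))))

  ¬On⇒off : ∀ {a} → ¬ On (σ ⟨$⟩ʳ a) → ¬ toℕ a < suc d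
  ¬On⇒off {a} off a<d = off (subst On (sym (σ-spine a a<d)) (on-spine (s≤s⁻¹ a<d)))

  h f : Fin n → ℕ
  h a = height (σ ⟨$⟩ʳ a)
  f a = foot (σ ⟨$⟩ʳ a)

  -- Two off-spine vertices are at distance at least two unless one is the parent of the other.
  e : Fin n → Fin n → ℚ
  e a b = guard (σ ⟨$⟩ʳ b ≟ parent (σ ⟨$⟩ʳ a)) ½

  D : Fin n → Fin n → ℕ
  D a b = dist G (σ ⟨$⟩ʳ a) (σ ⟨$⟩ʳ b)

  D-sym : ∀ a b → D a b ≡ D b a
  D-sym a b = dist-sym (proj₁ simple) dist<n (σ ⟨$⟩ʳ a) (σ ⟨$⟩ʳ b)

  e≥0 : ∀ a b → 0ℚ ≤ℚ e a b
  e≥0 a b = guard-≥0 (σ ⟨$⟩ʳ b ≟ parent (σ ⟨$⟩ʳ a)) 0≤½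

  private
    D-refl : ∀ {a} → inv (D a a) ≡ 0ℚ
    D-refl {a} = trans (cong inv (dist-refl {G = G} (σ ⟨$⟩ʳ a))) inv-0

    dist-label : ∀ a b → toℕ b < suc d → h a + ∣ f a - toℕ b ∣ ≤ D a b
    dist-label a b b≤d = subst (λ y → h a + ∣ f a - toℕ b ∣ ≤ dist G (σ ⟨$⟩ʳ a) y) (sym (σ-spine b b≤d))
      (dist-spine (σ ⟨$⟩ʳ a) (s≤s⁻¹ b≤d))

    mixed : ∀ a b → ¬ toℕ a < suc d → toℕ b < suc d → inv (D a b) ≤ℚ inv (h a + ∣ f a - toℕ b ∣)
    mixed a b a≰d b≤d = inv-≤ (≤-trans (≤-trans (s≤s z≤n) (≤-reflexive (sym (height-off (off⇒¬On a≰d))))) (m≤m+n (h a) _))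
      (dist-label a b b≤d)

    on-on : ∀ a b → toℕ a < suc d → toℕ b < suc d → inv (D a b) ≤ℚ inv ∣ toℕ a - toℕ b ∣
    on-on a b a≤d b≤d with a ≟ b
    ... | yes refl = subst (_≤ℚ _) (sym D-refl) (inv-≥0 ∣ toℕ a - toℕ a ∣)
    ... | no a≢b = inv-≤ (n≢0⇒n>0 (a≢b ∘ F.toℕ-injective ∘ ∣m-n∣≡0⇒m≡n))
        (subst₂ (λ h f → h + ∣ f - toℕ b ∣ ≤ D a b) h≡0 f≡a (dist-label a b b≤d))
      where
      on : On (σ ⟨$⟩ʳ a)
      on = subst On (sym (σ-spine a a≤d)) (on-spine (s≤s⁻¹ a≤d))
      h≡0 : h a ≡ 0
      h≡0 = height-on on
      f≡a : f a ≡ toℕ a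
      f≡a = trans (foot-on on) (trans (cong level (σ-spine a a≤d)) (level-spine (s≤s⁻¹ a≤d)))

    off-off : ∀ a b → inv (D a b) ≤ℚ guard (¬? (a ≟ b)) ½ +ℚ (e a b +ℚ e b a)
    off-off a b with a ≟ b
    ... | yes refl = subst (_≤ℚ 0ℚ +ℚ (e a a +ℚ e a a)) (sym D-refl)
        (ℚ.+-mono-≤ ℚ.≤-refl (ℚ.+-mono-≤ (e≥0 a a) (e≥0 a a)))
    ... | no a≢b = by-distance (D a b) refl
      where
      adjacent : T (G (σ ⟨$⟩ʳ a) (σ ⟨$⟩ʳ b)) → ½ ≤ℚ e a b +ℚ e b a
      adjacent edge with edge⇒parent edge
      ... | inj₁ eq = ℚ.≤-trans (ℚ.≤-reflexive (sym (guard-yes (σ ⟨$⟩ʳ b ≟ parent (σ ⟨$⟩ʳ a)) eq))) (p≤p+q (e≥0 b a))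
      ... | inj₂ eq = ℚ.≤-trans (ℚ.≤-reflexive (sym (guard-yes (σ ⟨$⟩ʳ a ≟ parent (σ ⟨$⟩ʳ b)) eq))) (p≤q+p (e≥0 a b))
      by-distance : ∀ k → D a b ≡ k → inv (D a b) ≤ℚ ½ +ℚ (e a b +ℚ e b a)
      by-distance zero eq = ⊥-elim (a≢b (permutation-injective σ (dist≡0⇒≡ eq)))
      by-distance (suc zero) eq with subst (λ k → Walk G k (σ ⟨$⟩ʳ a) (σ ⟨$⟩ʳ b)) eq (geodesic (dist<n _ _))
      ... | edge ∷ [] = subst (_≤ℚ ½ +ℚ (e a b +ℚ e b a)) (sym (trans (cong inv eq) inv-1)) (ℚ.+-monoʳ-≤ ½ (adjacent edge))
      by-distance (suc (suc k)) eq = ℚ.≤-trans (subst (inv (D a b) ≤ℚ_) inv-2 (inv-≤ (s≤s z≤n) (subst (2 ≤_) (sym eq) (s≤s (s≤s z≤n)))))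
        (p≤p+q (ℚ.+-mono-≤ (e≥0 a b) (e≥0 b a)))

  inv-dist≤split : ∀ a b → inv (D a b) ≤ℚ split h f e a b
  inv-dist≤split a b with onSpine? a | onSpine? b
  ... | yes a≤d | yes b≤d = subst (inv (D a b) ≤ℚ_) (sym (ℚ.+-identityʳ _)) (on-on a b a≤d b≤d)
  ... | no a≰d | yes b≤d = subst (inv (D a b) ≤ℚ_) (sym (trans (ℚ.+-identityˡ _) (ℚ.+-identityʳ _))) (mixed a b a≰d b≤d)
  ... | yes a≤d | no b≰d = subst₂ _≤ℚ_ (cong inv (D-sym b a)) (sym (trans (ℚ.+-identityˡ _) (ℚ.+-identityˡ _))) (mixed b a b≰d a≤d)
  ... | no _ | no _ = off-off a b

  -- Exactly one label names the parent.
  sum-e : ∀ a → sumFin (e a) ≡ ½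
  sum-e a = trans (sumFin-permute (λ x → guard (x ≟ parent (σ ⟨$⟩ʳ a)) ½) σ) (sumFin-δ (parent (σ ⟨$⟩ʳ a)) ½)

  -- At height 1 the parent is on the spine, so the row has no excess and the bound is exact. At
  -- greater height the excess is at most ½ and the row falls strictly short.
  branch-row : ∀ a → ¬ toℕ a < suc d →
    sumFin (branch h f e a) ≤ℚ pendentSum d (f a) × (pendentSum d (f a) ≤ℚ sumFin (branch h f e a) → h a ≡ 1)
  branch-row a a≰d = by-height (h a) refl
    where
    off : ¬ On (σ ⟨$⟩ʳ a)
    off = off⇒¬On a≰d
    by-height : ∀ k → h a ≡ k →
      sumFin (branch h f e a) ≤ℚ pendentSum d (f a) × (pendentSum d (f a) ≤ℚ sumFin (branch h f e a) → h a ≡ 1)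
    by-height zero eq with trans (sym eq) (height-off off)
    ... | ()
    by-height 1 eq = ℚ.≤-reflexive (trans (sumFin-cong {n} row) (spineSum d<n 1 (f a))) , λ _ → eq
      where
      row : ∀ b → branch h f e a b ≡ guard (onSpine? b) (inv (1 + ∣ f a - toℕ b ∣))
      row b with onSpine? a | onSpine? b
      ... | yes on | _ = ⊥-elim (a≰d on)
      ... | no _ | yes _ = cong (λ k → inv (k + ∣ f a - toℕ b ∣)) eq
      ... | no _ | no b≰d = guard-no (σ ⟨$⟩ʳ b ≟ parent (σ ⟨$⟩ʳ a)) λ eq′ →
            off⇒¬On b≰d (subst On (sym (trans eq′ (height≡1⇒parent off eq))) (on-spine (foot≤d (σ ⟨$⟩ʳ a))))
    by-height (suc (suc k)) eq = ℚ.<⇒≤ lt , λ ge → ⊥-elim (ℚ.<-irrefl refl (ℚ.<-≤-trans lt ge))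
      where
      spineRow : Fin n → ℚ
      spineRow b = guard (onSpine? b) (inv (h a + ∣ f a - toℕ b ∣))
      row : ∀ b → branch h f e a b ≤ℚ spineRow b +ℚ e a b
      row b with onSpine? a | onSpine? b
      ... | yes on | _ = ⊥-elim (a≰d on)
      ... | no _ | yes _ = p≤p+q (e≥0 a b)
      ... | no _ | no _ = p≤q+p ℚ.≤-refl
      lt : sumFin (branch h f e a) <ℚ pendentSum d (f a)
      lt = ℚ.≤-<-trans (sumFin-mono row)
        (subst (_<ℚ pendentSum d (f a)) (sym (trans (sumFin-+ spineRow (e a)) (cong₂ _+ℚ_ (spineSum d<n (h a) (f a)) (sum-e a))))
          (tallSum<pendentSum 0<d (foot≤d (σ ⟨$⟩ʳ a)) (subst (1 <_) (sym eq) (s≤s (s≤s z≤n)))))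

  on-parent : ∀ {x} → On x → On (parent x)
  on-parent {x} on = by-level (level x) refl
    where
    by-level : ∀ k → level x ≡ k → On (parent x)
    by-level zero eq = subst On (trans (level≡0⇒root eq) (sym (level≡0⇒root
      (n≤0⇒n≡0 (≤-trans (level-parent-≤ x) (≤-reflexive eq)))))) on
    by-level (suc k) eq = subst On (sym (trans (cong parent (trans on (cong spine eq))) (parent-spine k<d))) (on-spine (<⇒≤ k<d))
      where
      k<d : k < d
      k<d = subst (_≤ d) eq (level≤d x)

  module _ (heights : ∀ {x} → ¬ On x → height x ≡ 1) where

    -- An off-spine `x` is a leaf: a child on the spine would put `x` there too, and a child off it
    -- would have height 2.
    off-neighbour : ∀ {x z} → ¬ On x → T (G x z) → z ≡ spine (foot x)
    off-neighbour {x} {z} off edge with edge⇒parent edge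
    ... | inj₁ refl = height≡1⇒parent off (heights off)
    ... | inj₂ refl with on? z
    ...   | yes on = ⊥-elim (off (on-parent on))
    ...   | no off′ with trans (sym (heights off′)) (trans (height-off off′) (cong suc (heights off)))
    ...     | ()

    -- Neighbours of off-spine vertices are on the spine, so a walk of length 1 is impossible and
    -- the midpoint of one of length 2 is the foot of both ends.
    same-foot : ∀ {x y} → ¬ On x → ¬ On y → dist G x y ≤ 2 → foot x ≡ foot y
    same-foot {x} {y} off off′ le = by-walk (geodesic (dist<n x y)) le
      where
      by-walk : ∀ {k} → Walk G k x y → k ≤ 2 → foot x ≡ foot y
      by-walk [] _ = refl
      by-walk (edge ∷ []) _ = ⊥-elim (off′ (subst On (sym (off-neighbour off edge)) (on-spine (foot≤d x))))
      by-walk (edge ∷ (edge′ ∷ [])) _ = spine-injective (foot≤d x) (foot≤d y)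
        (trans (sym (off-neighbour off edge)) (off-neighbour off′ (flip-edge edge′)))
      by-walk (_ ∷ (_ ∷ (_ ∷ _))) (s≤s (s≤s ()))

  module _ {c : ℕ} (hung : ∀ {x} → ¬ On x → parent x ≡ spine c × T (G x (parent x))) where

    private
      off-spine : ∀ {x} → ¬ On x → ∀ {j} → j ≤ d → x ≢ spine j
      off-spine off j≤d refl = off (on-spine j≤d)

      classify : ∀ {x} → T (G x (parent x)) → SpineEdge d c spine x (parent x) ⊎ SpineEdge d c spine (parent x) x
      classify {x} edge with on? x
      ... | no off = inj₁ (subst (SpineEdge d c spine x) (sym (proj₁ (hung off))) (hanging (off-spine off)))
      ... | yes on = by-level (level x) refl
        where
        by-level : ∀ k → level x ≡ k → SpineEdge d c spine x (parent x) ⊎ SpineEdge d c spine (parent x) x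
        by-level zero eq = ⊥-elim (subst T (trans (cong (G x) fixed) (proj₂ simple x)) edge)
          where
          fixed : parent x ≡ x
          fixed = trans (level≡0⇒root (n≤0⇒n≡0 (≤-trans (level-parent-≤ x) (≤-reflexive eq)))) (sym (level≡0⇒root eq))
        by-level (suc k) eq = inj₂ (subst₂ (SpineEdge d c spine) (sym (trans (cong parent x≡) (parent-spine k<d))) (sym x≡) (along k<d))
          where
          k<d : k < d
          k<d = subst (_≤ d) eq (level≤d x)
          x≡ : x ≡ spine (suc k)
          x≡ = trans on (cong spine eq)

    edge⇒spineEdge : ∀ {x y} → T (G x y) → SpineEdge d c spine x y ⊎ SpineEdge d c spine y x
    edge⇒spineEdge edge with edge⇒parent edge
    ... | inj₁ refl = classify edge
    ... | inj₂ refl = swap (classify (flip-edge edge))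

    spineEdge⇒edge : ∀ {x y} → SpineEdge d c spine x y → T (G x y)
    spineEdge⇒edge (along {j} j<d) = flip-edge (subst (λ y → T (G (spine (suc j)) y)) (parent-spine j<d)
      (parent-edge (level-spine j<d)))
    spineEdge⇒edge {x} (hanging off) with on? x
    ... | yes on = ⊥-elim (off (level≤d x) on)
    ... | no off′ = subst (λ y → T (G x y)) (proj₁ (hung off′)) (proj₂ (hung off′))

-- Comparison and the equality case

module Comparison {n} (G : Graph n) (simple : IsSimple G) (acyclic : Acyclic G)
  (dist<n : ∀ x y → dist G x y < n) (root tip : Fin n) (d : ℕ)
  (tip-level : dist G tip root ≡ d) (level≤d : ∀ x → dist G x root ≤ d) (0<d : 0 < d) (d<n : d < n)
  (0<i : 0 < ⌊ d /2⌋) (i<d : ⌊ d /2⌋ < d) where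

  open Labelled n d
  open TreeBound G simple acyclic dist<n root tip d tip-level level≤d 0<d d<n
  open Spine G simple acyclic dist<n root tip d tip-level level≤d
  open Caterpillar n d ⌊ d /2⌋ 0<i i<d d<n
  open CaterpillarBound n d ⌊ d /2⌋ 0<i i<d d<n

  private
    i : ℕ
    i = ⌊ d /2⌋

    C : Graph n
    C = caterpillar n d i

    treeBranch catSplit : Fin n → Fin n → ℚ
    treeBranch = branch h f e
    catSplit = split (λ _ → 1) (λ _ → i) (λ _ _ → 0ℚ)

    2harary-G : harary G +ℚ harary G ≡ sumFin² λ a b → inv (D a b)
    2harary-G = trans (harary+harary G dist-refl (dist-sym (proj₁ simple) dist<n))
      (sym (sumFin²-permute (λ x y → inv (dist G x y)) σ))

    2harary-C : harary C +ℚ harary C ≡ sumFin² λ a b → inv (dist C a b)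
    2harary-C = harary+harary C dist-refl (dist-sym C-sym C-dist<n)

    tree-row≤ : ∀ a → sumFin (treeBranch a) ≤ℚ sumFin (catBranch a)
    tree-row≤ a = by-side (onSpine? a)
      where
      by-side : Dec (toℕ a < suc d) → sumFin (treeBranch a) ≤ℚ sumFin (catBranch a)
      by-side (yes on) = ℚ.≤-reflexive (trans (branch-row-on {h} {f} {e} a on)
        (sym (branch-row-on {λ _ → 1} {λ _ → i} {λ _ _ → 0ℚ} a on)))
      by-side (no off) = ℚ.≤-trans (proj₁ (branch-row a off)) (subst (pendentSum d (f a) ≤ℚ_) (sym (catBranch-row a off))
          (proj₁ (pendentSum-max d (foot≤d (σ ⟨$⟩ʳ a)))))

    branches≤ : sumFin² treeBranch ≤ℚ sumFin² catBranch
    branches≤ = sumFin-mono tree-row≤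

    splits≤ : sumFin² (split h f e) ≤ℚ sumFin² catSplit
    splits≤ = subst₂ _≤ℚ_ (sym (sum-split h f e)) (sym (sum-split (λ _ → 1) (λ _ → i) (λ _ _ → 0ℚ)))
      (ℚ.+-monoʳ-≤ (sumFin² core) (ℚ.+-mono-≤ branches≤ branches≤))

    tree≤split : harary G +ℚ harary G ≤ℚ sumFin² (split h f e)
    tree≤split = subst (_≤ℚ sumFin² (split h f e)) (sym 2harary-G) (sumFin²-mono inv-dist≤split)

    split≤cat : sumFin² catSplit ≤ℚ harary C +ℚ harary C
    split≤cat = subst (sumFin² catSplit ≤ℚ_) (sym 2harary-C) (sumFin²-mono split≤inv-dist)

  harary≤ : harary G ≤ℚ harary C
  harary≤ = double-cancel-≤ (ℚ.≤-trans tree≤split (ℚ.≤-trans splits≤ split≤cat))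

  module _ (equal : harary G ≡ harary C) where

    private
      2equal : harary C +ℚ harary C ≡ harary G +ℚ harary G
      2equal = cong₂ _+ℚ_ (sym equal) (sym equal)

      -- Equality of the indices closes the loop from tree through both splits to caterpillar and
      -- back; cancelling the common core leaves the branch sums, and rigidity descends to rows.
      cat-row≤ : ∀ a → sumFin (catBranch a) ≤ℚ sumFin (treeBranch a)
      cat-row≤ = sumFin-rigid tree-row≤ (double-cancel-≤ (+-rigidʳ {sumFin² core} ℚ.≤-refl (ℚ.+-mono-≤ branches≤ branches≤)
        (subst₂ _≤ℚ_ (sum-split (λ _ → 1) (λ _ → i) (λ _ _ → 0ℚ)) (sum-split h f e)
          (ℚ.≤-trans split≤cat (ℚ.≤-trans (ℚ.≤-reflexive 2equal) tree≤split)))))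

      split≤inv-D : ∀ a b → split h f e a b ≤ℚ inv (D a b)
      split≤inv-D = sumFin²-rigid inv-dist≤split
        (ℚ.≤-trans splits≤ (ℚ.≤-trans split≤cat (ℚ.≤-reflexive (trans 2equal 2harary-G))))

      extremal : ∀ a → ¬ toℕ a < suc d → h a ≡ 1 × (f a ≡ i ⊎ f a + i ≡ d)
      extremal a off = proj₂ (branch-row a off) (ℚ.≤-trans (proj₁ max) centre≤row)
                     , proj₂ max (ℚ.≤-trans centre≤row (proj₁ (branch-row a off)))
        where
        max = pendentSum-max d (foot≤d (σ ⟨$⟩ʳ a))
        centre≤row : pendentSum d i ≤ℚ sumFin (treeBranch a)
        centre≤row = subst (_≤ℚ sumFin (treeBranch a)) (catBranch-row a off) (cat-row≤ a)

      -- Tightness of the entrywise bound makes the reciprocal at least ½.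
      D≤2 : ∀ a b → ¬ toℕ a < suc d → ¬ toℕ b < suc d → D a b ≤ 2
      D≤2 a b a-off b-off with a ≟ b
      ... | yes refl = ≤-trans (≤-reflexive (dist-refl {G = G} (σ ⟨$⟩ʳ a))) z≤n
      ... | no a≢b = [ (λ le → le) , (λ ()) ]′ (inv-≤⁻¹ (≢⇒dist>0 (a≢b ∘ permutation-injective σ))
              (ℚ.≤-trans half≤split (split≤inv-D a b)))
        where
        half≤split : inv 2 ≤ℚ split h f e a b
        half≤split with onSpine? a | onSpine? b | a ≟ b
        ... | yes on | _ | _ = ⊥-elim (a-off on)
        ... | no _ | yes on | _ = ⊥-elim (b-off on)
        ... | no _ | no _ | yes eq = ⊥-elim (a≢b eq)
        ... | no _ | no _ | no _ = subst (_≤ℚ ½ +ℚ (e a b +ℚ e b a)) (sym inv-2) (p≤p+q (ℚ.+-mono-≤ (e≥0 a b) (e≥0 b a)))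

      off-label : ∀ {x} → ¬ On x → ¬ toℕ (σ ⟨$⟩ˡ x) < suc d
      off-label off = ¬On⇒off (off ∘ subst On (inverseʳ σ))

      heights : ∀ {x} → ¬ On x → height x ≡ 1
      heights {x} off = subst (λ y → height y ≡ 1) (inverseʳ σ) (proj₁ (extremal (σ ⟨$⟩ˡ x) (off-label off)))

      feet : ∀ {x y} → ¬ On x → ¬ On y → foot x ≡ foot y
      feet {x} {y} off off′ = same-foot heights off off′ (subst₂ (λ x y → dist G x y ≤ 2) (inverseʳ σ) (inverseʳ σ)
        (D≤2 (σ ⟨$⟩ˡ x) (σ ⟨$⟩ˡ y) (off-label off) (off-label off′)))

      common-foot : ∃[ c ] (c ≡ i ⊎ c + i ≡ d) × (∀ {x} → ¬ On x → foot x ≡ c)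
      common-foot with suc d <? n
      -- Here n = d + 1 and nothing is off the spine, so any foot qualifies vacuously; the centre is
      -- chosen.
      ... | no ¬lt = i , inj₁ refl , λ {x} off → ⊥-elim (¬lt (≤-trans (s≤s (≮⇒≥ (off-label off))) (F.toℕ<n (σ ⟨$⟩ˡ x))))
      ... | yes lt = f b , proj₂ (extremal b b-off) , λ off → feet off (off⇒¬On b-off)
        where
        b : Fin n
        b = fromℕ< lt
        b-off : ¬ toℕ b < suc d
        b-off = <-irrefl (F.toℕ-fromℕ< lt)

      i≤d : i ≤ d
      i≤d = <⇒≤ i<d

    isomorphic : G ≅ C
    isomorphic with common-foot
    ... | c , centred , feet-c = by-side centred
      where
      hung : ∀ {x} → ¬ On x → parent x ≡ spine c × T (G x (parent x))
      hung off = trans (height≡1⇒parent off (heights off)) (cong spine (feet-c off)) , parent-edge (proj₂ (off-level off))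
      by-side : c ≡ i ⊎ c + i ≡ d → G ≅ C
      by-side (inj₁ refl) = ≅-caterpillar G (proj₁ simple) i≤d d<n spine spine-injective
        (edge⇒spineEdge hung) (spineEdge⇒edge hung)
      by-side (inj₂ c+i≡d) = ≅-caterpillar G (proj₁ simple) i≤d d<n (λ j → spine (d ∸ j))
        (reverse-injective spine spine-injective)
        ([ spineEdge-reverse c+i≡d spine , swap ∘ spineEdge-reverse c+i≡d spine ]′ ∘ edge⇒spineEdge hung)
        ([ spineEdge⇒edge hung , flip-edge ∘ spineEdge⇒edge hung ]′ ∘ spineEdge-unreverse c+i≡d spine)

theorem3p7 : (n d : ℕ) → 2 ≤ d → d < n →
    (IsTree (caterpillar n d ⌊ d /2⌋) × HasDiameter (caterpillar n d ⌊ d /2⌋) d)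
    × ((T : Graph n) → IsTree T → HasDiameter T d →
    harary T ≤ℚ harary (caterpillar n d ⌊ d /2⌋)
    × (harary T ≡ harary (caterpillar n d ⌊ d /2⌋) → T ≅ caterpillar n d ⌊ d /2⌋))
theorem3p7 n d@(suc (suc d′)) (s≤s (s≤s _)) d<n = (C-tree , C-diameter) ,
  λ { G (simple , _ , acyclic) (dist≤d , tip , root , tip-level) →
      -- The diameter bound keeps every distance below the default `n` of a failed search, so all
      -- geodesics exist.
      let open Comparison G simple acyclic (λ x y → ≤-<-trans (dist≤d x y) d<n) root tip d
                 tip-level (λ x → dist≤d x root) (s≤s z≤n) d<n (s≤s z≤n) (⌊n/2⌋<n (suc d′))
      in harary≤ , isomorphic }
  where open Caterpillar n d ⌊ d /2⌋ (s≤s z≤n) (⌊n/2⌋<n (suc d′)) d<n
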